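{- There exists a two-sided error non-adaptive tester for $k$-monotonicity of functions $f\colon[n]\to\{0,1\}$ with query complexity $q(n,\varepsilon,k)=\tilde O(1/\varepsilon^7)$, independent of $k$ (and of $n$).
   Context: $[n]=\{1,\dots,n\}$ with its usual order. A function $f\colon[n]\to\{0,1\}$ is $k$-monotone if there are no $x_1\le\cdots\le x_{k+1}$ with $f(x_1)=1$ and $f(x_i)\ne f(x_{i+1})$ for all $i\in[k]$. Distance is normalized Hamming distance under the uniform distribution; $\varepsilon$-far means distance at least $\varepsilon$ to every $k$-monotone function. A tester, given $\varepsilon$ and query access to $f$, accepts $k$-monotone $f$ with probability at least $2/3$ and rejects $\varepsilon$-far $f$ with probability at least $2/3$ (two-sided: errors allowed in both cases); non-adaptive means queries do not depend on previous answers. $\tilde O(g)$ denotes $O(g\log^c g)$ for some constant $c\ge0$. -}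

module Defs where

open import Data.Nat as ℕ using (ℕ; zero; suc)
open import Data.Fin using (Fin; zero; suc; toℕ; inject₁)
open import Data.Bool using (Bool; true; false; if_then_else_)
open import Data.Product using (Σ; _×_; ∃)
open import Data.List using (List; []; _∷_)
open import Data.List.Relation.Unary.All using (All)
open import Data.Integer using (+_)
open import Data.Rational as ℚ using (ℚ; 0ℚ; 1ℚ)
open import Relation.Binary.PropositionalEquality using (_≡_; _≢_)
open import Relation.Nullary using (¬_)

-- [n] is modelled as Fin n, ordered by toℕ (the usual order).
-- A function f : [n] → {0,1} is modelled as Fin n → Bool (true = 1).

Violation : (k n : ℕ) → (Fin n → Bool) → Set
Violation k n f =
  Σ (Fin (suc k) → Fin n) λ x →
    (∀ (i : Fin k) → toℕ (x (inject₁ i)) ℕ.≤ toℕ (x (suc i)))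
    × (f (x zero) ≡ true)
    × (∀ (i : Fin k) → f (x (inject₁ i)) ≢ f (x (suc i)))

KMonotone : (k n : ℕ) → (Fin n → Bool) → Set
KMonotone k n f = ¬ Violation k n f

count : ∀ {n} → (Fin n → Bool) → ℕ
count {zero}  p = 0
count {suc n} p = (if p zero then 1 else 0) ℕ.+ count (λ i → p (suc i))

differ : Bool → Bool → Bool
differ true  true  = false
differ false false = false
differ _     _     = true

hamming : ∀ {n} → (Fin n → Bool) → (Fin n → Bool) → ℕ
hamming f g = count (λ i → differ (f i) (g i))

ℕtoℚ : ℕ → ℚ
ℕtoℚ m = + m ℚ./ 1

-- f is ε-far from k-monotone: for every k-monotone g, dist(f,g) = hamming f g / n ≥ ε,
-- written without division as ε · n ≤ hamming f g.
Far : (k n : ℕ) → ℚ → (Fin n → Bool) → Set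
Far k n ε f = ∀ (g : Fin n → Bool) → KMonotone k n g → ε ℚ.* ℕtoℚ n ℚ.≤ ℕtoℚ (hamming f g)

-- A non-adaptive randomized tester on [n] making q queries: a finite probability
-- distribution over deterministic strategies; each strategy fixes q query points
-- (independently of answers) and a decision (accept = true) from the q answers.
record Strategy (n q : ℕ) : Set where
  field
    weight  : ℚ
    queries : Fin q → Fin n
    decide  : (Fin q → Bool) → Bool

Tester : (n q : ℕ) → Set
Tester n q = List (Strategy n q)

totalWeight : ∀ {n q} → Tester n q → ℚ
totalWeight [] = 0ℚ
totalWeight (s ∷ t) = Strategy.weight s ℚ.+ totalWeight t

IsDistribution : ∀ {n q} → Tester n q → Set
IsDistribution t = All (λ s → 0ℚ ℚ.≤ Strategy.weight s) t × (totalWeight t ≡ 1ℚ)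

accProb : ∀ {n q} → Tester n q → (Fin n → Bool) → ℚ
accProb [] f = 0ℚ
accProb (s ∷ t) f =
  (if Strategy.decide s (λ j → f (Strategy.queries s j)) then Strategy.weight s else 0ℚ)
  ℚ.+ accProb t f

IsKMonTester : (k n : ℕ) (ε : ℚ) {q : ℕ} → Tester n q → Set
IsKMonTester k n ε t =
  IsDistribution t ×
  (∀ (f : Fin n → Bool) →
      (KMonotone k n f → + 2 ℚ./ 3 ℚ.≤ accProb t f)
    × (Far k n ε f → accProb t f ℚ.≤ + 1 ℚ./ 3))

{-# OPTIONS --safe #-}
module Submission where

-- Cut [n] into N = O(m (k + 1)) cells of length s and round f to its value at the
-- left end of each cell.  If f is k-monotone, it differs from the rounding in at
-- most k (s - 1) points, and the rounding changes value at most k times (counting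
-- a leading true as a change).  Suppose instead that f is 1/m-far.  Either f
-- differs from the rounding in a fraction at least 1/(4m) of the points, or the
-- rounding itself is far and has k + r changes with r at least (k + 1)/(8m):
-- flattening the stretch between changes j and j + 2r makes it k-monotone for each
-- j = 0, ..., k, and a point lies in at most 2r of these k + 1 stretches.  Since
-- N = O(m (k + 1)), both quantities are means of a bit read with three queries
-- around a uniform point, and the two cases differ by at least 1/(64 m²), whatever
-- k and n are.  By Chebyshev O(m⁴) samples tell them apart.

open import Defs
open import Data.Bool using (Bool; true; false; if_then_else_; _∧_; not)
import Data.Bool.Properties as Boolₚ
open import Data.Empty using (⊥; ⊥-elim)
open import Data.Fin using (Fin; zero; suc; toℕ; fromℕ; fromℕ<; inject₁; combine; remQuot)
open import Data.Fin.Induction using (<-weakInduction)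
import Data.Fin.Properties as Finₚ
open import Data.Integer as ℤ using (ℤ; +_; 0ℤ)
import Data.Integer.Properties as ℤₚ
import Data.Integer.Tactic.RingSolver as ℤ-Ring
open import Data.List using (List; []; _∷_; _++_; map; length; cartesianProductWith; applyUpTo; upTo)
open import Data.List.Properties using (length-++; length-map; length-upTo; map-upTo)
open import Data.List.Relation.Unary.All using (All; []; _∷_)
open import Data.Nat using (ℕ; zero; suc; pred; _+_; _*_; _∸_; _⊓_; _⊔_; _/_; _%_; _^_; _≤_; _<_; z≤n; s≤s; NonZero; _≤ᵇ_; _<ᵇ_)
open import Data.Nat.Divisibility using (divides-refl)
open import Data.Nat.DivMod using (m<n*o⇒m/o<n; +-distrib-/-∣ˡ; m*n/n≡m; m<n⇒m/n≡0; /-monoˡ-≤; m/n*n≤m; m≡m%n+[m/n]*n; m%n<n)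
open import Data.Nat.ListAction using (sum)
open import Data.Nat.Logarithm using (⌊log₂_⌋)
import Data.Nat.Properties as ℕₚ
import Data.Nat.Tactic.RingSolver as ℕ-Ring
open import Data.Product using (Σ; _×_; _,_; proj₁; proj₂; ∃)
open import Data.Rational as ℚ using (ℚ; 0ℚ; 1ℚ)
import Data.Rational.Properties as ℚₚ
open import Data.Rational.Unnormalised as ℚᵘ using (mkℚᵘ; *≡*; *≤*)
import Data.Rational.Unnormalised.Properties as ℚᵘₚ
open import Data.Sum as Sum using (_⊎_; inj₁; inj₂)
open import Data.Unit using (tt)
open import Data.Vec as Vec using (Vec; []; _∷_)
import Data.Vec.Properties as Vecₚ
open import Function using (_∘_)
open import Relation.Binary.PropositionalEquality
open import Relation.Nullary using (¬_; yes; no)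

private variable A B C : Set

-- Counting the elements of a list that satisfy a test.

⟦_⟧ : Bool → ℕ
⟦ b ⟧ = if b then 1 else 0

⟦⟧≤1 : ∀ b → ⟦ b ⟧ ≤ 1
⟦⟧≤1 true  = s≤s z≤n
⟦⟧≤1 false = z≤n

countOf : (A → Bool) → List A → ℕ
countOf p xs = sum (map (λ x → ⟦ p x ⟧) xs)

countOf≤length : (p : A → Bool) (xs : List A) → countOf p xs ≤ length xs
countOf≤length p []       = z≤n
countOf≤length p (x ∷ xs) = ℕₚ.+-mono-≤ (⟦⟧≤1 (p x)) (countOf≤length p xs)

countOf-not : (p : A → Bool) (xs : List A) → countOf p xs + countOf (λ x → not (p x)) xs ≡ length xs
countOf-not p [] = refl
countOf-not p (x ∷ xs) with p x
... | true  = cong suc (countOf-not p xs)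
... | false = trans (ℕₚ.+-suc _ _) (cong suc (countOf-not p xs))

countOf-mono : (p q : A → Bool) → (∀ x → p x ≡ true → q x ≡ true) → ∀ xs → countOf p xs ≤ countOf q xs
countOf-mono p q imp [] = z≤n
countOf-mono p q imp (x ∷ xs) with p x in px | q x in qx
... | false | _     = ℕₚ.≤-trans (countOf-mono p q imp xs) (ℕₚ.m≤n+m _ _)
... | true  | true  = s≤s (countOf-mono p q imp xs)
... | true  | false with () ← trans (sym qx) (imp x px)

-- Union bound: a conjunction fails only where a conjunct fails. It controls a verdict made of two
-- threshold tests.
countOf-not-∧ : (p q : A → Bool) → ∀ xs →
  countOf (λ x → not (p x ∧ q x)) xs ≤ countOf (not ∘ p) xs + countOf (not ∘ q) xs
countOf-not-∧ p q [] = z≤n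
countOf-not-∧ p q (x ∷ xs) with p x | q x
... | true  | true  = countOf-not-∧ p q xs
... | true  | false = ℕₚ.≤-trans (s≤s (countOf-not-∧ p q xs)) (ℕₚ.≤-reflexive (sym (ℕₚ.+-suc _ _)))
... | false | true  = s≤s (countOf-not-∧ p q xs)
... | false | false = s≤s (ℕₚ.≤-trans (countOf-not-∧ p q xs) (ℕₚ.+-monoʳ-≤ _ (ℕₚ.n≤1+n _)))

-- Second moments of uniform samples

∑ : List A → (A → ℤ) → ℤ
∑ []       f = 0ℤ
∑ (x ∷ xs) f = f x ℤ.+ ∑ xs f

∑-cong : (xs : List A) {f g : A → ℤ} → (∀ x → f x ≡ g x) → ∑ xs f ≡ ∑ xs g
∑-cong []       eq = refl
∑-cong (x ∷ xs) eq = cong₂ ℤ._+_ (eq x) (∑-cong xs eq)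

∑-mono-≤ : (xs : List A) {f g : A → ℤ} → (∀ x → f x ℤ.≤ g x) → ∑ xs f ℤ.≤ ∑ xs g
∑-mono-≤ []       le = ℤₚ.≤-refl
∑-mono-≤ (x ∷ xs) le = ℤₚ.+-mono-≤ (le x) (∑-mono-≤ xs le)

∑-++ : (xs ys : List A) (f : A → ℤ) → ∑ (xs ++ ys) f ≡ ∑ xs f ℤ.+ ∑ ys f
∑-++ []       ys f = sym (ℤₚ.+-identityˡ _)
∑-++ (x ∷ xs) ys f = trans (cong (ℤ._+_ (f x)) (∑-++ xs ys f)) (sym (ℤₚ.+-assoc (f x) _ _))

∑-map : (g : A → B) (xs : List A) (f : B → ℤ) → ∑ (map g xs) f ≡ ∑ xs (λ x → f (g x))
∑-map g []       f = refl
∑-map g (x ∷ xs) f = cong (ℤ._+_ (f (g x))) (∑-map g xs f)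

∑-cartesianProductWith : (g : A → B → C) (xs : List A) (ys : List B) (f : C → ℤ) →
  ∑ (cartesianProductWith g xs ys) f ≡ ∑ xs (λ x → ∑ ys (λ y → f (g x y)))
∑-cartesianProductWith g []       ys f = refl
∑-cartesianProductWith g (x ∷ xs) ys f =
  trans (∑-++ (map (g x) ys) _ f)
        (cong₂ ℤ._+_ (∑-map (g x) ys f) (∑-cartesianProductWith g xs ys f))

∑-affine : (xs : List A) (z : A → ℤ) (p q r : ℤ) →
  ∑ xs (λ x → p ℤ.* (z x ℤ.* z x) ℤ.+ q ℤ.* z x ℤ.+ r)
    ≡ p ℤ.* ∑ xs (λ x → z x ℤ.* z x) ℤ.+ q ℤ.* ∑ xs z ℤ.+ + length xs ℤ.* r
∑-affine []       z p q r = vanish p q r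
  where
  vanish : ∀ p q r → 0ℤ ≡ p ℤ.* 0ℤ ℤ.+ q ℤ.* 0ℤ ℤ.+ 0ℤ ℤ.* r
  vanish = ℤ-Ring.solve-∀
∑-affine (x ∷ xs) z p q r = begin
  p ℤ.* (z x ℤ.* z x) ℤ.+ q ℤ.* z x ℤ.+ r ℤ.+ ∑ xs (λ x → p ℤ.* (z x ℤ.* z x) ℤ.+ q ℤ.* z x ℤ.+ r)
    ≡⟨ cong (ℤ._+_ (p ℤ.* (z x ℤ.* z x) ℤ.+ q ℤ.* z x ℤ.+ r)) (∑-affine xs z p q r) ⟩
  p ℤ.* (z x ℤ.* z x) ℤ.+ q ℤ.* z x ℤ.+ r ℤ.+ (p ℤ.* s₂ ℤ.+ q ℤ.* s₁ ℤ.+ l ℤ.* r)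
    ≡⟨ rearrange p q r (z x) s₂ s₁ l ⟩
  p ℤ.* (z x ℤ.* z x ℤ.+ s₂) ℤ.+ q ℤ.* (z x ℤ.+ s₁) ℤ.+ (ℤ.1ℤ ℤ.+ l) ℤ.* r ∎
  where
  open ≡-Reasoning
  s₁ s₂ l : ℤ
  s₁ = ∑ xs z
  s₂ = ∑ xs (λ x → z x ℤ.* z x)
  l = + length xs
  rearrange : ∀ p q r z s₂ s₁ l →
    p ℤ.* (z ℤ.* z) ℤ.+ q ℤ.* z ℤ.+ r ℤ.+ (p ℤ.* s₂ ℤ.+ q ℤ.* s₁ ℤ.+ l ℤ.* r)
      ≡ p ℤ.* (z ℤ.* z ℤ.+ s₂) ℤ.+ q ℤ.* (z ℤ.+ s₁) ℤ.+ (ℤ.1ℤ ℤ.+ l) ℤ.* r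
  rearrange = ℤ-Ring.solve-∀

∑-const : (xs : List A) (r : ℤ) → ∑ xs (λ _ → r) ≡ + length xs ℤ.* r
∑-const []       r = sym (ℤₚ.*-zeroˡ r)
∑-const (x ∷ xs) r = trans (cong (λ s → r ℤ.+ s) (∑-const xs r)) (sym (ℤₚ.suc-* (+ length xs) r))

length-cartesianProductWith : (g : A → B → C) (xs : List A) (ys : List B) →
  length (cartesianProductWith g xs ys) ≡ length xs * length ys
length-cartesianProductWith g []       ys = refl
length-cartesianProductWith g (x ∷ xs) ys =
  trans (length-++ (map (g x) ys))
        (cong₂ _+_ (length-map (g x) ys) (length-cartesianProductWith g xs ys))

-- The product space as a list with repetitions, so that counting in it measures events of `T`
-- independent uniform draws from `Ω`.
tuples : List A → (T : ℕ) → List (Vec A T)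
tuples Ω zero    = [] ∷ []
tuples Ω (suc T) = cartesianProductWith _∷_ Ω (tuples Ω T)

length-tuples : (Ω : List A) (T : ℕ) → length (tuples Ω T) ≡ length Ω ^ T
length-tuples Ω zero    = refl
length-tuples Ω (suc T) =
  trans (length-cartesianProductWith _∷_ Ω (tuples Ω T)) (cong (length Ω *_) (length-tuples Ω T))

sumᶻ : ∀ {T} → (A → ℤ) → Vec A T → ℤ
sumᶻ z v = Vec.foldr′ ℤ._+_ 0ℤ (Vec.map z v)

-- The free offset `a` carries the induction: fixing the first coordinate `x` turns `a` into
-- `a + z x`. Averaging over `x` kills the cross term, because `z` sums to zero, and each coordinate
-- adds at most `V`.
second-moment : (Ω : List A) (z : A → ℤ) (V : ℤ) →
  ∑ Ω z ≡ 0ℤ → ∑ Ω (λ x → z x ℤ.* z x) ℤ.≤ + length Ω ℤ.* V → ∀ T (a : ℤ) →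
  ∑ (tuples Ω T) (λ v → (a ℤ.+ sumᶻ z v) ℤ.* (a ℤ.+ sumᶻ z v))
    ℤ.≤ + (length Ω ^ T) ℤ.* (a ℤ.* a ℤ.+ + T ℤ.* V)
second-moment Ω z V mean var zero a = ℤₚ.≤-reflexive (base a V)
  where
  base : ∀ a V → (a ℤ.+ 0ℤ) ℤ.* (a ℤ.+ 0ℤ) ℤ.+ 0ℤ ≡ ℤ.1ℤ ℤ.* (a ℤ.* a ℤ.+ 0ℤ ℤ.* V)
  base = ℤ-Ring.solve-∀
second-moment Ω z V mean var (suc T) a = begin
  ∑ (tuples Ω (suc T)) (λ v → (a ℤ.+ sumᶻ z v) ℤ.* (a ℤ.+ sumᶻ z v))
    ≡⟨ ∑-cartesianProductWith _∷_ Ω (tuples Ω T) _ ⟩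
  ∑ Ω (λ x → ∑ (tuples Ω T) (λ v → (a ℤ.+ (z x ℤ.+ sumᶻ z v)) ℤ.* (a ℤ.+ (z x ℤ.+ sumᶻ z v))))
    ≡⟨ ∑-cong Ω (λ x → ∑-cong (tuples Ω T) (λ v →
         cong (λ y → y ℤ.* y) (sym (ℤₚ.+-assoc a (z x) (sumᶻ z v))))) ⟩
  ∑ Ω (λ x → ∑ (tuples Ω T) (λ v → (a ℤ.+ z x ℤ.+ sumᶻ z v) ℤ.* (a ℤ.+ z x ℤ.+ sumᶻ z v)))
    ≤⟨ ∑-mono-≤ Ω (λ x → second-moment Ω z V mean var T (a ℤ.+ z x)) ⟩
  ∑ Ω (λ x → P ℤ.* ((a ℤ.+ z x) ℤ.* (a ℤ.+ z x) ℤ.+ + T ℤ.* V))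
    ≡⟨ ∑-cong Ω (λ x → expand P a (z x) (+ T ℤ.* V)) ⟩
  ∑ Ω (λ x → P ℤ.* (z x ℤ.* z x) ℤ.+ (+ 2) ℤ.* P ℤ.* a ℤ.* z x ℤ.+ P ℤ.* (a ℤ.* a ℤ.+ + T ℤ.* V))
    ≡⟨ ∑-affine Ω z P ((+ 2) ℤ.* P ℤ.* a) (P ℤ.* (a ℤ.* a ℤ.+ + T ℤ.* V)) ⟩
  P ℤ.* ∑ Ω (λ x → z x ℤ.* z x) ℤ.+ (+ 2) ℤ.* P ℤ.* a ℤ.* ∑ Ω z ℤ.+ M ℤ.* (P ℤ.* (a ℤ.* a ℤ.+ + T ℤ.* V))
    ≤⟨ ℤₚ.+-monoˡ-≤ _ (ℤₚ.+-mono-≤ (ℤₚ.*-monoˡ-≤-nonNeg P var)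
         (ℤₚ.≤-reflexive (cong (ℤ._*_ ((+ 2) ℤ.* P ℤ.* a)) mean))) ⟩
  P ℤ.* (M ℤ.* V) ℤ.+ (+ 2) ℤ.* P ℤ.* a ℤ.* 0ℤ ℤ.+ M ℤ.* (P ℤ.* (a ℤ.* a ℤ.+ + T ℤ.* V))
    ≡⟨ collect P M V a (+ T) ⟩
  M ℤ.* P ℤ.* (a ℤ.* a ℤ.+ (ℤ.1ℤ ℤ.+ + T) ℤ.* V)
    ≡⟨ cong (ℤ._* (a ℤ.* a ℤ.+ + suc T ℤ.* V)) (sym (ℤₚ.pos-* (length Ω) (length Ω ^ T))) ⟩
  + (length Ω ^ suc T) ℤ.* (a ℤ.* a ℤ.+ + suc T ℤ.* V) ∎
  where
  open ℤₚ.≤-Reasoning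
  P M : ℤ
  P = + (length Ω ^ T)
  M = + length Ω
  expand : ∀ P a z w → P ℤ.* ((a ℤ.+ z) ℤ.* (a ℤ.+ z) ℤ.+ w)
    ≡ P ℤ.* (z ℤ.* z) ℤ.+ (+ 2) ℤ.* P ℤ.* a ℤ.* z ℤ.+ P ℤ.* (a ℤ.* a ℤ.+ w)
  expand = ℤ-Ring.solve-∀
  collect : ∀ P M V a T →
    P ℤ.* (M ℤ.* V) ℤ.+ (+ 2) ℤ.* P ℤ.* a ℤ.* 0ℤ ℤ.+ M ℤ.* (P ℤ.* (a ℤ.* a ℤ.+ T ℤ.* V))
      ≡ M ℤ.* P ℤ.* (a ℤ.* a ℤ.+ (ℤ.1ℤ ℤ.+ T) ℤ.* V)
  collect = ℤ-Ring.solve-∀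

-- The inequalities of Markov and Chebyshev.

Far-apart : ℕ → ℕ → ℕ → Set
Far-apart D u w = (D + u ≤ w) ⊎ (D + w ≤ u)

far-apart-square : ∀ {D u w} → Far-apart D u w →
  + (D * D) ℤ.≤ (+ u ℤ.- + w) ℤ.* (+ u ℤ.- + w)
far-apart-square {D} {u} {w} (inj₁ le) with ℕₚ.m≤n⇒∃[o]m+o≡n le
... | o , refl = begin
  + (D * D)             ≤⟨ ℤ.+≤+ (ℕₚ.*-mono-≤ (ℕₚ.m≤m+n D o) (ℕₚ.m≤m+n D o)) ⟩
  + ((D + o) * (D + o)) ≡⟨ trans (ℤₚ.pos-* (D + o) (D + o)) (cong₂ ℤ._*_ (ℤₚ.pos-+ D o) (ℤₚ.pos-+ D o)) ⟩
  (+ D ℤ.+ + o) ℤ.* (+ D ℤ.+ + o)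
    ≡⟨ identity (+ D) (+ u) (+ o) ⟩
  (+ u ℤ.- (+ D ℤ.+ + u ℤ.+ + o)) ℤ.* (+ u ℤ.- (+ D ℤ.+ + u ℤ.+ + o))
    ≡⟨⟩
  (+ u ℤ.- + (D + u + o)) ℤ.* (+ u ℤ.- + (D + u + o)) ∎
  where
  open ℤₚ.≤-Reasoning
  identity : ∀ d u o → (d ℤ.+ o) ℤ.* (d ℤ.+ o)
    ≡ (u ℤ.- (d ℤ.+ u ℤ.+ o)) ℤ.* (u ℤ.- (d ℤ.+ u ℤ.+ o))
  identity = ℤ-Ring.solve-∀
far-apart-square {D} {u} {w} (inj₂ le) =
  subst (+ (D * D) ℤ.≤_) (swap (+ w) (+ u)) (far-apart-square {D} {w} {u} (inj₁ le))
  where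
  swap : ∀ a b → (a ℤ.- b) ℤ.* (a ℤ.- b) ≡ (b ℤ.- a) ℤ.* (b ℤ.- a)
  swap = ℤ-Ring.solve-∀

-- An `x` passing `p` contributes at least `d` to the sum, and every other one at least zero.
markov : (p : A → Bool) (g : A → ℤ) (d : ℕ) → (∀ x → 0ℤ ℤ.≤ g x) →
  (∀ x → p x ≡ true → + d ℤ.≤ g x) → (xs : List A) → + (countOf p xs * d) ℤ.≤ ∑ xs g
markov p g d nonneg large [] = ℤₚ.≤-refl
markov p g d nonneg large (x ∷ xs) with p x in eq
... | true  = ℤₚ.+-mono-≤ (large x eq) (markov p g d nonneg large xs)
... | false = ℤₚ.+-mono-≤ (nonneg x) (markov p g d nonneg large xs)

square-nonneg : ∀ i → 0ℤ ℤ.≤ i ℤ.* i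
square-nonneg (+ n)      = subst (0ℤ ℤ.≤_) (ℤₚ.pos-* n n) (ℤ.+≤+ z≤n)
square-nonneg ℤ.-[1+ n ] = ℤ.+≤+ z≤n

successes : ∀ {T} → (A → Bool) → Vec A T → ℕ
successes c v = Vec.sum (Vec.map (λ x → ⟦ c x ⟧) v)

module _ (Ω : List A) (c : A → Bool) where
  private
    M a : ℕ
    M = length Ω
    a = countOf c Ω

  -- The centred indicator of `c`, multiplied by `M` so that the mean `a / M` needs no division.
  deviation : A → ℤ
  deviation x = + (M * ⟦ c x ⟧) ℤ.- + a

  private
    ∑-deviation : ∀ (m b : ℕ) xs →
      ∑ xs (λ x → + (m * ⟦ c x ⟧) ℤ.- + b) ≡ + m ℤ.* + countOf c xs ℤ.- + length xs ℤ.* + b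
    ∑-deviation m b [] = base (+ m) (+ b)
      where
      base : ∀ m b → 0ℤ ≡ m ℤ.* 0ℤ ℤ.- 0ℤ ℤ.* b
      base = ℤ-Ring.solve-∀
    ∑-deviation m b (x ∷ xs) = begin
      + (m * ⟦ c x ⟧) ℤ.- + b ℤ.+ ∑ xs _
        ≡⟨ cong₂ (λ i j → i ℤ.- + b ℤ.+ j) (ℤₚ.pos-* m ⟦ c x ⟧) (∑-deviation m b xs) ⟩
      + m ℤ.* + ⟦ c x ⟧ ℤ.- + b ℤ.+ (+ m ℤ.* + countOf c xs ℤ.- + length xs ℤ.* + b)
        ≡⟨ step (+ m) (+ ⟦ c x ⟧) (+ b) (+ countOf c xs) (+ length xs) ⟩
      + m ℤ.* (+ ⟦ c x ⟧ ℤ.+ + countOf c xs) ℤ.- (ℤ.1ℤ ℤ.+ + length xs) ℤ.* + b ∎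
      where
      open ≡-Reasoning
      step : ∀ m i b s l → m ℤ.* i ℤ.- b ℤ.+ (m ℤ.* s ℤ.- l ℤ.* b)
        ≡ m ℤ.* (i ℤ.+ s) ℤ.- (ℤ.1ℤ ℤ.+ l) ℤ.* b
      step = ℤ-Ring.solve-∀

  deviation-mean : ∑ Ω deviation ≡ 0ℤ
  deviation-mean = trans (∑-deviation M a Ω) (ℤₚ.+-inverseʳ (+ M ℤ.* + a))

  -- Both `M * ⟦ c x ⟧` and `a` lie between 0 and `M`. This crude variance bound suffices.
  deviation-square : ∀ x → deviation x ℤ.* deviation x ℤ.≤ + (M * M)
  deviation-square x = begin
    deviation x ℤ.* deviation x     ≡⟨ square-abs (deviation x) ⟩
    + (ℤ.∣ deviation x ∣ * ℤ.∣ deviation x ∣) ≤⟨ ℤ.+≤+ (ℕₚ.*-mono-≤ bound bound) ⟩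
    + (M * M)                       ∎
    where
    open ℤₚ.≤-Reasoning
    square-abs : ∀ i → i ℤ.* i ≡ + (ℤ.∣ i ∣ * ℤ.∣ i ∣)
    square-abs (+ n)      = sym (ℤₚ.pos-* n n)
    square-abs ℤ.-[1+ n ] = refl
    bound : ℤ.∣ deviation x ∣ ≤ M
    bound = ℕₚ.≤-trans (ℕₚ.≤-reflexive (cong ℤ.∣_∣ (ℤₚ.m-n≡m⊖n (M * ⟦ c x ⟧) a)))
      (ℕₚ.≤-trans (ℤₚ.∣m⊝n∣≤m⊔n (M * ⟦ c x ⟧) a)
        (ℕₚ.⊔-lub (ℕₚ.≤-trans (ℕₚ.*-monoʳ-≤ M (⟦⟧≤1 (c x))) (ℕₚ.≤-reflexive (ℕₚ.*-identityʳ M)))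
                  (countOf≤length c Ω)))

  sum-deviation : ∀ {T} (v : Vec A T) → sumᶻ deviation v ≡ + (M * successes c v) ℤ.- + (T * a)
  sum-deviation [] = cong (λ k → + k ℤ.- 0ℤ) (sym (ℕₚ.*-zeroʳ M))
  sum-deviation {suc T} (x ∷ v) = begin
    deviation x ℤ.+ sumᶻ deviation v
      ≡⟨ cong (ℤ._+_ (deviation x)) (sum-deviation v) ⟩
    (+ (M * ⟦ c x ⟧) ℤ.- + a) ℤ.+ (+ (M * successes c v) ℤ.- + (T * a))
      ≡⟨ step (+ (M * ⟦ c x ⟧)) (+ a) (+ (M * successes c v)) (+ (T * a)) ⟩
    + (M * ⟦ c x ⟧ + M * successes c v) ℤ.- + (a + T * a)
      ≡⟨ cong (λ k → + k ℤ.- + (a + T * a)) (sym (ℕₚ.*-distribˡ-+ M ⟦ c x ⟧ _)) ⟩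
    + (M * (⟦ c x ⟧ + successes c v)) ℤ.- + (a + T * a) ∎
    where
    open ≡-Reasoning
    step : ∀ i a s t → (i ℤ.- a) ℤ.+ (s ℤ.- t) ≡ (i ℤ.+ s) ℤ.- (a ℤ.+ t)
    step = ℤ-Ring.solve-∀

  -- Markov's inequality for the squared sum of deviations, whose mean is at most `T * (M * M)` by
  -- `second-moment` with offset zero.
  chebyshev : ∀ T D (p : Vec A T → Bool) →
    (∀ v → p v ≡ true → Far-apart D (M * successes c v) (T * a)) →
    countOf p (tuples Ω T) * (D * D) ≤ M ^ T * (T * (M * M))
  chebyshev T D p far = ℤₚ.drop‿+≤+ (begin
    + (countOf p (tuples Ω T) * (D * D))
      ≤⟨ markov p g (D * D) (λ v → square-nonneg (0ℤ ℤ.+ sumᶻ deviation v)) large (tuples Ω T) ⟩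
    ∑ (tuples Ω T) g
      ≤⟨ second-moment Ω deviation (+ (M * M)) deviation-mean
           (ℤₚ.≤-trans (∑-mono-≤ Ω deviation-square) (ℤₚ.≤-reflexive (∑-const Ω (+ (M * M))))) T 0ℤ ⟩
    + (M ^ T) ℤ.* (0ℤ ℤ.+ + T ℤ.* + (M * M))
      ≡⟨ cong (ℤ._*_ (+ (M ^ T))) (trans (ℤₚ.+-identityˡ _) (sym (ℤₚ.pos-* T (M * M)))) ⟩
    + (M ^ T) ℤ.* + (T * (M * M))
      ≡⟨ sym (ℤₚ.pos-* (M ^ T) (T * (M * M))) ⟩
    + (M ^ T * (T * (M * M))) ∎)
    where
    open ℤₚ.≤-Reasoning
    g : Vec A T → ℤ
    g v = (0ℤ ℤ.+ sumᶻ deviation v) ℤ.* (0ℤ ℤ.+ sumᶻ deviation v)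
    large : ∀ v → p v ≡ true → + (D * D) ℤ.≤ g v
    large v eq = subst (λ i → + (D * D) ℤ.≤ i ℤ.* i)
      (sym (trans (ℤₚ.+-identityˡ _) (sum-deviation v))) (far-apart-square {D} (far v eq))

-- Testers drawing a strategy uniformly

toℚᵘ-ℕtoℚ : ∀ m → ℚ.toℚᵘ (ℕtoℚ m) ℚᵘ.≃ mkℚᵘ (+ m) 0
toℚᵘ-ℕtoℚ m = ℚₚ.toℚᵘ-fromℚᵘ (mkℚᵘ (+ m) 0)

ℕtoℚ-+ : ∀ a b → ℕtoℚ (a + b) ≡ ℕtoℚ a ℚ.+ ℕtoℚ b
ℕtoℚ-+ a b = ℚₚ.toℚᵘ-injective (begin-equality
  ℚ.toℚᵘ (ℕtoℚ (a + b))                        ≃⟨ toℚᵘ-ℕtoℚ (a + b) ⟩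
  mkℚᵘ (+ a ℤ.+ + b) 0                         ≃⟨ *≡* (identity (+ a) (+ b)) ⟩
  mkℚᵘ (+ a) 0 ℚᵘ.+ mkℚᵘ (+ b) 0               ≃⟨ ℚᵘₚ.+-cong (toℚᵘ-ℕtoℚ a) (toℚᵘ-ℕtoℚ b) ⟨
  ℚ.toℚᵘ (ℕtoℚ a) ℚᵘ.+ ℚ.toℚᵘ (ℕtoℚ b)         ≃⟨ ℚₚ.toℚᵘ-homo-+ (ℕtoℚ a) (ℕtoℚ b) ⟨
  ℚ.toℚᵘ (ℕtoℚ a ℚ.+ ℕtoℚ b)                   ∎)
  where
  open ℚᵘₚ.≤-Reasoning
  identity : ∀ a b → (a ℤ.+ b) ℤ.* ℤ.1ℤ ≡ (a ℤ.* ℤ.1ℤ ℤ.+ b ℤ.* ℤ.1ℤ) ℤ.* ℤ.1ℤ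
  identity = ℤ-Ring.solve-∀

ℕtoℚ-* : ∀ a b → ℕtoℚ (a * b) ≡ ℕtoℚ a ℚ.* ℕtoℚ b
ℕtoℚ-* a b = ℚₚ.toℚᵘ-injective (begin-equality
  ℚ.toℚᵘ (ℕtoℚ (a * b))                        ≃⟨ toℚᵘ-ℕtoℚ (a * b) ⟩
  mkℚᵘ (+ (a * b)) 0                           ≃⟨ *≡* (cong (ℤ._* ℤ.1ℤ) (ℤₚ.pos-* a b)) ⟩
  mkℚᵘ (+ a) 0 ℚᵘ.* mkℚᵘ (+ b) 0               ≃⟨ ℚᵘₚ.*-cong (toℚᵘ-ℕtoℚ a) (toℚᵘ-ℕtoℚ b) ⟨
  ℚ.toℚᵘ (ℕtoℚ a) ℚᵘ.* ℚ.toℚᵘ (ℕtoℚ b)         ≃⟨ ℚₚ.toℚᵘ-homo-* (ℕtoℚ a) (ℕtoℚ b) ⟨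
  ℚ.toℚᵘ (ℕtoℚ a ℚ.* ℕtoℚ b)                   ∎)
  where open ℚᵘₚ.≤-Reasoning

ℕtoℚ-mono-≤ : ∀ {a b} → a ≤ b → ℕtoℚ a ℚ.≤ ℕtoℚ b
ℕtoℚ-mono-≤ {a} {b} a≤b = ℚₚ.toℚᵘ-cancel-≤ (begin
  ℚ.toℚᵘ (ℕtoℚ a)   ≃⟨ toℚᵘ-ℕtoℚ a ⟩
  mkℚᵘ (+ a) 0      ≤⟨ *≤* (ℤₚ.*-monoʳ-≤-nonNeg ℤ.1ℤ (ℤ.+≤+ a≤b)) ⟩
  mkℚᵘ (+ b) 0      ≃⟨ toℚᵘ-ℕtoℚ b ⟨
  ℚ.toℚᵘ (ℕtoℚ b)   ∎)
  where open ℚᵘₚ.≤-Reasoning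

ℕtoℚ-cancel-≤ : ∀ {a b} → ℕtoℚ a ℚ.≤ ℕtoℚ b → a ≤ b
ℕtoℚ-cancel-≤ {a} {b} le with
  ℚᵘₚ.≤-trans (ℚᵘₚ.≤-reflexive (ℚᵘₚ.≃-sym (toℚᵘ-ℕtoℚ a)))
    (ℚᵘₚ.≤-trans (ℚₚ.toℚᵘ-mono-≤ le) (ℚᵘₚ.≤-reflexive (toℚᵘ-ℕtoℚ b)))
... | *≤* le′ = ℤₚ.drop‿+≤+ (subst₂ ℤ._≤_ (ℤₚ.*-identityʳ (+ a)) (ℤₚ.*-identityʳ (+ b)) le′)

ℕtoℚ-inverse : ∀ P .{{_ : NonZero P}} → ℕtoℚ P ℚ.* (+ 1 ℚ./ P) ≡ 1ℚ
ℕtoℚ-inverse P@(suc P-1) = ℚₚ.toℚᵘ-injective (begin-equality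
  ℚ.toℚᵘ (ℕtoℚ P ℚ.* (+ 1 ℚ./ P))              ≃⟨ ℚₚ.toℚᵘ-homo-* (ℕtoℚ P) (+ 1 ℚ./ P) ⟩
  ℚ.toℚᵘ (ℕtoℚ P) ℚᵘ.* ℚ.toℚᵘ (+ 1 ℚ./ P)
    ≃⟨ ℚᵘₚ.*-cong (toℚᵘ-ℕtoℚ P) (ℚₚ.toℚᵘ-fromℚᵘ (mkℚᵘ (+ 1) P-1)) ⟩
  mkℚᵘ (+ P) 0 ℚᵘ.* mkℚᵘ (+ 1) P-1             ≃⟨ *≡* (identity (+ P)) ⟩
  ℚᵘ.1ℚᵘ                                       ∎)
  where
  open ℚᵘₚ.≤-Reasoning
  identity : ∀ p → p ℤ.* ℤ.1ℤ ℤ.* ℤ.1ℤ ≡ ℤ.1ℤ ℤ.* (ℤ.1ℤ ℤ.* p)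
  identity = ℤ-Ring.solve-∀

⅓ : ℚ
⅓ = + 1 ℚ./ 3

third-of-triple : ∀ c → ℕtoℚ c ≡ ⅓ ℚ.* ℕtoℚ (3 * c)
third-of-triple c = begin
  ℕtoℚ c                       ≡⟨ ℚₚ.*-identityˡ (ℕtoℚ c) ⟨
  ⅓ ℚ.* ℕtoℚ 3 ℚ.* ℕtoℚ c      ≡⟨ ℚₚ.*-assoc ⅓ (ℕtoℚ 3) (ℕtoℚ c) ⟩
  ⅓ ℚ.* (ℕtoℚ 3 ℚ.* ℕtoℚ c)    ≡⟨ cong (⅓ ℚ.*_) (ℕtoℚ-* 3 c) ⟨
  ⅓ ℚ.* ℕtoℚ (3 * c)           ∎
  where open ≡-Reasoning

module _ (P : ℕ) .{{_ : NonZero P}} where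
  private
    w : ℚ
    w = + 1 ℚ./ P

    w-nonNeg : ℚ.NonNegative w
    w-nonNeg = ℚₚ.normalize-nonNeg 1 P

    rescale : ∀ b → ⅓ ℚ.* ℕtoℚ (b * P) ℚ.* w ≡ ⅓ ℚ.* ℕtoℚ b
    rescale b = begin
      ⅓ ℚ.* ℕtoℚ (b * P) ℚ.* w             ≡⟨ cong (λ x → ⅓ ℚ.* x ℚ.* w) (ℕtoℚ-* b P) ⟩
      ⅓ ℚ.* (ℕtoℚ b ℚ.* ℕtoℚ P) ℚ.* w      ≡⟨ cong (ℚ._* w) (ℚₚ.*-assoc ⅓ (ℕtoℚ b) (ℕtoℚ P)) ⟨
      ⅓ ℚ.* ℕtoℚ b ℚ.* ℕtoℚ P ℚ.* w        ≡⟨ ℚₚ.*-assoc (⅓ ℚ.* ℕtoℚ b) (ℕtoℚ P) w ⟩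
      ⅓ ℚ.* ℕtoℚ b ℚ.* (ℕtoℚ P ℚ.* w)      ≡⟨ cong (⅓ ℚ.* ℕtoℚ b ℚ.*_) (ℕtoℚ-inverse P) ⟩
      ⅓ ℚ.* ℕtoℚ b ℚ.* 1ℚ                  ≡⟨ ℚₚ.*-identityʳ _ ⟩
      ⅓ ℚ.* ℕtoℚ b                         ∎
      where open ≡-Reasoning

    scale-mono : ∀ {c d} → c ≤ d → ⅓ ℚ.* ℕtoℚ c ℚ.* w ℚ.≤ ⅓ ℚ.* ℕtoℚ d ℚ.* w
    scale-mono c≤d = ℚₚ.*-monoʳ-≤-nonNeg w {{w-nonNeg}} (ℚₚ.*-monoˡ-≤-nonNeg ⅓ (ℕtoℚ-mono-≤ c≤d))

  -- Carries a comparison of counts over to probabilities, through multiplication by `⅓` and `w`.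
  -- The cases `b = 1` here and `b = 2` in `fraction-≥` are the two error thresholds.
  fraction-≤ : ∀ c b → 3 * c ≤ b * P → ℕtoℚ c ℚ.* w ℚ.≤ ⅓ ℚ.* ℕtoℚ b
  fraction-≤ c b le =
    subst₂ ℚ._≤_ (cong (ℚ._* w) (sym (third-of-triple c))) (rescale b) (scale-mono le)

  fraction-≥ : ∀ c b → b * P ≤ 3 * c → ⅓ ℚ.* ℕtoℚ b ℚ.≤ ℕtoℚ c ℚ.* w
  fraction-≥ c b le =
    subst₂ ℚ._≤_ (rescale b) (cong (ℚ._* w) (sym (third-of-triple c))) (scale-mono le)

module _ {n q : ℕ} (queries : A → Fin q → Fin n) (decide : A → (Fin q → Bool) → Bool) where

  strategy : ℚ → A → Strategy n q
  strategy w x = record { weight = w ; queries = queries x ; decide = decide x }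

  accepted : (Fin n → Bool) → A → Bool
  accepted f x = decide x (λ j → f (queries x j))

  private
    ℕtoℚ-suc : ∀ w c → w ℚ.+ ℕtoℚ c ℚ.* w ≡ ℕtoℚ (suc c) ℚ.* w
    ℕtoℚ-suc w c = begin
      w ℚ.+ ℕtoℚ c ℚ.* w              ≡⟨ cong (ℚ._+ ℕtoℚ c ℚ.* w) (ℚₚ.*-identityˡ w) ⟨
      1ℚ ℚ.* w ℚ.+ ℕtoℚ c ℚ.* w       ≡⟨ ℚₚ.*-distribʳ-+ w 1ℚ (ℕtoℚ c) ⟨
      (1ℚ ℚ.+ ℕtoℚ c) ℚ.* w           ≡⟨ cong (ℚ._* w) (ℕtoℚ-+ 1 c) ⟨
      ℕtoℚ (suc c) ℚ.* w              ∎
      where open ≡-Reasoning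

  totalWeight-strategies : ∀ w xs → totalWeight (map (strategy w) xs) ≡ ℕtoℚ (length xs) ℚ.* w
  totalWeight-strategies w []       = sym (ℚₚ.*-zeroˡ w)
  totalWeight-strategies w (x ∷ xs) =
    trans (cong (w ℚ.+_) (totalWeight-strategies w xs)) (ℕtoℚ-suc w (length xs))

  accProb-strategies : ∀ w f xs →
    accProb (map (strategy w) xs) f ≡ ℕtoℚ (countOf (accepted f) xs) ℚ.* w
  accProb-strategies w f []       = sym (ℚₚ.*-zeroˡ w)
  accProb-strategies w f (x ∷ xs) with accepted f x
  ... | true  = trans (cong (w ℚ.+_) (accProb-strategies w f xs)) (ℕtoℚ-suc w (countOf (accepted f) xs))
  ... | false = trans (ℚₚ.+-identityˡ _) (accProb-strategies w f xs)

  nonneg-strategies : ∀ w → 0ℚ ℚ.≤ w → ∀ xs → All (λ s → 0ℚ ℚ.≤ Strategy.weight s) (map (strategy w) xs)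
  nonneg-strategies w 0≤w []       = []
  nonneg-strategies w 0≤w (x ∷ xs) = 0≤w ∷ nonneg-strategies w 0≤w xs

  module _ (xs : List A) .{{_ : NonZero (length xs)}} where

    uniformTester : Tester n q
    uniformTester = map (strategy (+ 1 ℚ./ length xs)) xs

    uniformTester-isDistribution : IsDistribution uniformTester
    uniformTester-isDistribution =
      nonneg-strategies _ (ℚₚ.nonNegative⁻¹ _ {{ℚₚ.normalize-nonNeg 1 (length xs)}}) xs ,
      trans (totalWeight-strategies _ xs) (ℕtoℚ-inverse (length xs))

    uniformTester-accepts : ∀ f → 3 * countOf (not ∘ accepted f) xs ≤ length xs →
      + 2 ℚ./ 3 ℚ.≤ accProb uniformTester f
    uniformTester-accepts f rarely =
      subst (+ 2 ℚ./ 3 ℚ.≤_) (sym (accProb-strategies _ f xs))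
        -- Acceptances and rejections together number `length xs`, so a third of rejections at most
        -- leaves two thirds of acceptances at least.
        (fraction-≥ (length xs) accs 2 (ℕₚ.+-cancelʳ-≤ (length xs) _ _ (begin
          2 * length xs + length xs        ≡⟨ ℕₚ.+-comm (2 * length xs) (length xs) ⟩
          3 * length xs                    ≡⟨ cong (3 *_) (countOf-not (accepted f) xs) ⟨
          3 * (accs + rejs)                ≡⟨ ℕₚ.*-distribˡ-+ 3 accs rejs ⟩
          3 * accs + 3 * rejs              ≤⟨ ℕₚ.+-monoʳ-≤ (3 * accs) rarely ⟩
          3 * accs + length xs             ∎)))
      where
      open ℕₚ.≤-Reasoning
      accs rejs : ℕ
      accs = countOf (accepted f) xs
      rejs = countOf (not ∘ accepted f) xs

    uniformTester-rejects : ∀ f → 3 * countOf (accepted f) xs ≤ length xs →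
      accProb uniformTester f ℚ.≤ + 1 ℚ./ 3
    uniformTester-rejects f rarely =
      subst (ℚ._≤ + 1 ℚ./ 3) (sym (accProb-strategies _ f xs))
        (fraction-≤ (length xs) (countOf (accepted f) xs) 1 (ℕₚ.≤-trans rarely (ℕₚ.≤-reflexive (sym (ℕₚ.*-identityˡ _)))))

-- Thresholding empirical means

-- The factor 24 yields failure probability 1/6: the summed variance is at most 24 (M W)², and the
-- squared margin is 144 (M W)².
sampleSize : ℕ → ℕ
sampleSize W = 24 * (W * W)

-- Half of 1 / W on the scale of `M * S`, that is T M / (2 W) for T = 24 W².
margin : ℕ → ℕ → ℕ
margin W M = M * (12 * W)

-- The empirical mean exceeds a / M by at most half of 1 / W.
below : (W M a S : ℕ) → Bool
below W M a S = M * S ≤ᵇ sampleSize W * a + margin W M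

below-true : ∀ W M a S → below W M a S ≡ true → M * S ≤ sampleSize W * a + margin W M
below-true W M a S eq = ℕₚ.≤ᵇ⇒≤ (M * S) _ (subst Data.Bool.T (sym eq) tt)

below-false : ∀ W M a S → not (below W M a S) ≡ true → sampleSize W * a + margin W M ≤ M * S
below-false W M a S eq = ℕₚ.<⇒≤ (ℕₚ.≰⇒> λ le → refute (below W M a S) (ℕₚ.≤⇒≤ᵇ le) eq)
  where
  refute : ∀ p → Data.Bool.T p → not p ≡ true → ⊥
  refute true _ ()

module _ (W : ℕ) .{{_ : NonZero W}} (Ω : List A) .{{_ : NonZero (length Ω)}} where
  private
    M T : ℕ
    M = length Ω
    T = sampleSize W

  -- One sixth rather than one third, so that two statistics together still fail with probability at
  -- most one third.
  concentration : (c : A → Bool) (p : Vec A T → Bool) →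
    (∀ v → p v ≡ true → Far-apart (margin W M) (M * successes c v) (T * countOf c Ω)) →
    6 * countOf p (tuples Ω T) ≤ length (tuples Ω T)
  concentration c p far = ℕₚ.*-cancelʳ-≤ (6 * cnt) (length (tuples Ω T)) (24 * (W * W) * (M * M)) (begin
    6 * cnt * (24 * (W * W) * (M * M))             ≡⟨ identity cnt W M ⟩
    cnt * (margin W M * margin W M)                ≤⟨ chebyshev Ω c T (margin W M) p far ⟩
    M ^ T * (T * (M * M))                          ≡⟨ cong (_* (T * (M * M))) (length-tuples Ω T) ⟨
    length (tuples Ω T) * (24 * (W * W) * (M * M)) ∎)
    where
    open ℕₚ.≤-Reasoning
    cnt : ℕ
    cnt = countOf p (tuples Ω T)
    identity : ∀ c W M → 6 * c * (24 * (W * W) * (M * M)) ≡ c * (M * (12 * W) * (M * (12 * W)))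
    identity = ℕ-Ring.solve-∀
    instance
      WW≢0 : NonZero (W * W)
      WW≢0 = ℕₚ.m*n≢0 W W
      MM≢0 : NonZero (M * M)
      MM≢0 = ℕₚ.m*n≢0 M M
      24WW≢0 : NonZero (24 * (W * W))
      24WW≢0 = ℕₚ.m*n≢0 24 (W * W)
      24WWMM≢0 : NonZero (24 * (W * W) * (M * M))
      24WWMM≢0 = ℕₚ.m*n≢0 (24 * (W * W)) (M * M)

  rarely-above : ∀ c a → countOf c Ω ≤ a →
    6 * countOf (λ v → not (below W M a (successes c v))) (tuples Ω T) ≤ length (tuples Ω T)
  rarely-above c a small = concentration c _ λ v above → inj₂ (begin
    margin W M + T * countOf c Ω    ≡⟨ ℕₚ.+-comm (margin W M) _ ⟩
    T * countOf c Ω + margin W M    ≤⟨ ℕₚ.+-monoˡ-≤ (margin W M) (ℕₚ.*-monoʳ-≤ T small) ⟩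
    T * a + margin W M              ≤⟨ below-false W M a (successes c v) above ⟩
    M * successes c v               ∎)
    where open ℕₚ.≤-Reasoning

  -- The threshold uses up half of the gap 1 / W between the true mean and `a / M`, so a sample
  -- below the threshold deviates by at least the other half.
  rarely-below : ∀ c a → W * a + M ≤ W * countOf c Ω →
    6 * countOf (λ v → below W M a (successes c v)) (tuples Ω T) ≤ length (tuples Ω T)
  rarely-below c a large = concentration c _ λ v under → inj₁ (begin
    margin W M + M * successes c v        ≤⟨ ℕₚ.+-monoʳ-≤ (margin W M) (below-true W M a (successes c v) under) ⟩
    margin W M + (T * a + margin W M)     ≡⟨ identity W M a ⟩
    24 * W * (W * a + M)                  ≤⟨ ℕₚ.*-monoʳ-≤ (24 * W) large ⟩
    24 * W * (W * countOf c Ω)            ≡⟨ assoc W (countOf c Ω) ⟩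
    T * countOf c Ω                       ∎)
    where
    open ℕₚ.≤-Reasoning
    identity : ∀ W M a → M * (12 * W) + (24 * (W * W) * a + M * (12 * W)) ≡ 24 * W * (W * a + M)
    identity = ℕ-Ring.solve-∀
    assoc : ∀ W x → 24 * W * (W * x) ≡ 24 * (W * W) * x
    assoc = ℕ-Ring.solve-∀

-- Testers that compare two sample means with thresholds.

successes-map : ∀ {T} (g : A → B) (c : B → Bool) (v : Vec A T) →
  successes c (Vec.map g v) ≡ successes (c ∘ g) v
successes-map g c v = cong Vec.sum (sym (Vecₚ.map-∘ _ g v))

module _ {n r : ℕ} (points : A → Vec (Fin n) r) where

  -- The sample stays next to its bits because a statistic may also depend on the position sampled.
  read : (Fin n → Bool) → A → A × Vec Bool r
  read f x = x , Vec.map f (points x)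

  module _ {T : ℕ} where

    -- The queries are fixed by the drawn `v` before any answer is seen, so the tester is
    -- non-adaptive. An index below `T * r` encodes a sample together with one of its `r` points.
    sampleQueries : Vec A T → Fin (T * r) → Fin n
    sampleQueries v j = Vec.lookup (points (Vec.lookup v (proj₁ (remQuot r j)))) (proj₂ (remQuot {T} r j))

    readings : Vec A T → (Fin (T * r) → Bool) → Vec (A × Vec Bool r) T
    readings v ans = Vec.tabulate λ t → Vec.lookup v t , Vec.tabulate λ i → ans (combine t i)

    readings-sampleQueries : ∀ f v → readings v (f ∘ sampleQueries v) ≡ Vec.map (read f) v
    readings-sampleQueries f v = begin
      readings v (f ∘ sampleQueries v)            ≡⟨ Vecₚ.tabulate-cong reading ⟩
      Vec.tabulate (read f ∘ Vec.lookup v)        ≡⟨ Vecₚ.tabulate-∘ (read f) (Vec.lookup v) ⟩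
      Vec.map (read f) (Vec.tabulate (Vec.lookup v)) ≡⟨ cong (Vec.map (read f)) (Vecₚ.tabulate∘lookup v) ⟩
      Vec.map (read f) v                          ∎
      where
      open ≡-Reasoning
      reading : ∀ t → (Vec.lookup v t , Vec.tabulate λ i → f (sampleQueries v (combine t i)))
        ≡ read f (Vec.lookup v t)
      reading t = cong (Vec.lookup v t ,_) (begin
        Vec.tabulate (λ i → f (sampleQueries v (combine t i)))
          ≡⟨ Vecₚ.tabulate-cong (λ i → cong
               (λ ti → f (Vec.lookup (points (Vec.lookup v (proj₁ ti))) (proj₂ ti)))
               (Finₚ.remQuot-combine t i)) ⟩
        Vec.tabulate (f ∘ Vec.lookup (points (Vec.lookup v t)))
          ≡⟨ Vecₚ.tabulate-∘ f (Vec.lookup (points (Vec.lookup v t))) ⟩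
        Vec.map f (Vec.tabulate (Vec.lookup (points (Vec.lookup v t))))
          ≡⟨ cong (Vec.map f) (Vecₚ.tabulate∘lookup (points (Vec.lookup v t))) ⟩
        Vec.map f (points (Vec.lookup v t)) ∎)

  module _ (W : ℕ) .{{_ : NonZero W}} (Ω : List A) .{{_ : NonZero (length Ω)}}
           (X Y : A × Vec Bool r → Bool) (a b : ℕ) where
    private
      M T : ℕ
      M = length Ω
      T = sampleSize W

      instance
        tuples≢0 : NonZero (length (tuples Ω T))
        tuples≢0 = subst NonZero (sym (length-tuples Ω T)) (ℕₚ.m^n≢0 M T)

    verdict : Vec A T → (Fin (T * r) → Bool) → Bool
    verdict v ans = below W M a (successes X (readings v ans)) ∧ below W M b (successes Y (readings v ans))

    meanTester : Tester n (T * r)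
    meanTester = uniformTester sampleQueries verdict (tuples Ω T)

    meanTester-isDistribution : IsDistribution meanTester
    meanTester-isDistribution = uniformTester-isDistribution sampleQueries verdict (tuples Ω T)

    module _ (f : Fin n → Bool) where
      private
        X′ Y′ : A → Bool
        X′ = X ∘ read f
        Y′ = Y ∘ read f
        belowX belowY : Vec A T → Bool
        belowX v = below W M a (successes X′ v)
        belowY v = below W M b (successes Y′ v)

        outcome : ∀ v → accepted sampleQueries verdict f v ≡ belowX v ∧ belowY v
        outcome v = cong₂ (λ s t → below W M a s ∧ below W M b t) (statistic X) (statistic Y)
          where
          statistic : ∀ Z → successes Z (readings v (f ∘ sampleQueries v)) ≡ successes (Z ∘ read f) v
          statistic Z = trans (cong (successes Z) (readings-sampleQueries f v)) (successes-map (read f) Z v)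

      meanTester-accepts : countOf (X ∘ read f) Ω ≤ a → countOf (Y ∘ read f) Ω ≤ b →
        + 2 ℚ./ 3 ℚ.≤ accProb meanTester f
      meanTester-accepts smallX smallY = uniformTester-accepts sampleQueries verdict (tuples Ω T) f
        -- Doubling turns the required third into two sixths, one for each threshold test.
        (ℕₚ.*-cancelˡ-≤ 2 (begin
          2 * (3 * countOf (not ∘ accepted sampleQueries verdict f) (tuples Ω T))
            ≡⟨ ℕₚ.*-assoc 2 3 (countOf (not ∘ accepted sampleQueries verdict f) (tuples Ω T)) ⟨
          6 * countOf (not ∘ accepted sampleQueries verdict f) (tuples Ω T)
            ≤⟨ ℕₚ.*-monoʳ-≤ 6 (countOf-mono _ (λ v → not (belowX v ∧ belowY v))
                 (λ v eq → trans (cong not (sym (outcome v))) eq) (tuples Ω T)) ⟩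
          6 * countOf (λ v → not (belowX v ∧ belowY v)) (tuples Ω T)
            ≤⟨ ℕₚ.*-monoʳ-≤ 6 (countOf-not-∧ belowX belowY (tuples Ω T)) ⟩
          6 * (countOf (not ∘ belowX) (tuples Ω T) + countOf (not ∘ belowY) (tuples Ω T))
            ≡⟨ ℕₚ.*-distribˡ-+ 6 (countOf (not ∘ belowX) (tuples Ω T)) _ ⟩
          6 * countOf (not ∘ belowX) (tuples Ω T) + 6 * countOf (not ∘ belowY) (tuples Ω T)
            ≤⟨ ℕₚ.+-mono-≤ (rarely-above W Ω X′ a smallX) (rarely-above W Ω Y′ b smallY) ⟩
          length (tuples Ω T) + length (tuples Ω T)
            ≡⟨ cong (_+_ (length (tuples Ω T))) (ℕₚ.+-identityʳ _) ⟨
          2 * length (tuples Ω T) ∎))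
        where open ℕₚ.≤-Reasoning

      -- One large mean is enough: the verdict is a conjunction, so it accepts no more often than
      -- either of its tests.
      meanTester-rejects : (W * a + M ≤ W * countOf (X ∘ read f) Ω) ⊎ (W * b + M ≤ W * countOf (Y ∘ read f) Ω) →
        accProb meanTester f ℚ.≤ + 1 ℚ./ 3
      meanTester-rejects large = uniformTester-rejects sampleQueries verdict (tuples Ω T) f
        (ℕₚ.≤-trans (ℕₚ.*-monoˡ-≤ (countOf (accepted sampleQueries verdict f) (tuples Ω T)) {3} {6} (s≤s (s≤s (s≤s z≤n))))
          (rare large))
        where
        ∧-left : ∀ {p q} → p ∧ q ≡ true → p ≡ true
        ∧-left {true} _ = refl
        ∧-right : ∀ {p q} → p ∧ q ≡ true → q ≡ true
        ∧-right {true} eq = eq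
        rare : (W * a + M ≤ W * countOf (X ∘ read f) Ω) ⊎ (W * b + M ≤ W * countOf (Y ∘ read f) Ω) →
          6 * countOf (accepted sampleQueries verdict f) (tuples Ω T) ≤ length (tuples Ω T)
        rare (inj₁ largeX) = ℕₚ.≤-trans
          (ℕₚ.*-monoʳ-≤ 6 (countOf-mono _ belowX
            (λ v eq → ∧-left (trans (sym (outcome v)) eq)) (tuples Ω T)))
          (rarely-below W Ω X′ a largeX)
        rare (inj₂ largeY) = ℕₚ.≤-trans
          (ℕₚ.*-monoʳ-≤ 6 (countOf-mono _ belowY
            (λ v eq → ∧-right {belowX v} (trans (sym (outcome v)) eq)) (tuples Ω T)))
          (rarely-below W Ω Y′ b largeY)

-- Changes of value and k-monotonicity

Σ< : ℕ → (ℕ → ℕ) → ℕ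
Σ< n f = sum (applyUpTo f n)

countOf-upTo : ∀ c n → countOf c (upTo n) ≡ Σ< n (λ x → ⟦ c x ⟧)
countOf-upTo c n = cong sum (map-upTo (λ x → ⟦ c x ⟧) n)

Σ<-mono : ∀ n {f g} → (∀ i → i < n → f i ≤ g i) → Σ< n f ≤ Σ< n g
Σ<-mono zero    le = z≤n
Σ<-mono (suc n) le = ℕₚ.+-mono-≤ (le 0 (s≤s z≤n)) (Σ<-mono n (λ i i<n → le (suc i) (s≤s i<n)))

Σ<-cong : ∀ n {f g} → (∀ i → i < n → f i ≡ g i) → Σ< n f ≡ Σ< n g
Σ<-cong zero    eq = refl
Σ<-cong (suc n) eq = cong₂ _+_ (eq 0 (s≤s z≤n)) (Σ<-cong n (λ i i<n → eq (suc i) (s≤s i<n)))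

Σ<-+ : ∀ n f g → Σ< n (λ i → f i + g i) ≡ Σ< n f + Σ< n g
Σ<-+ zero    f g = refl
Σ<-+ (suc n) f g = trans (cong (λ z → f 0 + g 0 + z) (Σ<-+ n (f ∘ suc) (g ∘ suc)))
  (interchange (f 0) (g 0) (Σ< n (f ∘ suc)) (Σ< n (g ∘ suc)))
  where
  interchange : ∀ a b c d → a + b + (c + d) ≡ a + c + (b + d)
  interchange = ℕ-Ring.solve-∀

Σ<-* : ∀ n c f → Σ< n (λ i → c * f i) ≡ c * Σ< n f
Σ<-* zero    c f = sym (ℕₚ.*-zeroʳ c)
Σ<-* (suc n) c f = trans (cong (λ z → c * f 0 + z) (Σ<-* n c (f ∘ suc))) (sym (ℕₚ.*-distribˡ-+ c (f 0) _))

Σ<-const : ∀ n c → Σ< n (λ _ → c) ≡ n * c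
Σ<-const zero    c = refl
Σ<-const (suc n) c = cong (λ z → c + z) (Σ<-const n c)

Σ<-swap : ∀ m n (f : ℕ → ℕ → ℕ) → Σ< m (λ i → Σ< n (f i)) ≡ Σ< n (λ j → Σ< m (λ i → f i j))
Σ<-swap zero    n f = sym (trans (Σ<-const n 0) (ℕₚ.*-zeroʳ n))
Σ<-swap (suc m) n f = trans (cong (λ z → Σ< n (f 0) + z) (Σ<-swap m n (f ∘ suc)))
  (sym (Σ<-+ n (f 0) (λ j → Σ< m (λ i → f (suc i) j))))

Σ<-split : ∀ m n f → Σ< (m + n) f ≡ Σ< m f + Σ< n (λ i → f (m + i))
Σ<-split zero    n f = refl
Σ<-split (suc m) n f = trans (cong (λ z → f 0 + z) (Σ<-split m n (f ∘ suc))) (sym (ℕₚ.+-assoc (f 0) _ _))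

Σ<-snoc : ∀ n f → Σ< (suc n) f ≡ Σ< n f + f n
Σ<-snoc zero    f = ℕₚ.+-identityʳ (f 0)
Σ<-snoc (suc n) f = trans (cong (λ z → f 0 + z) (Σ<-snoc n (f ∘ suc))) (sym (ℕₚ.+-assoc (f 0) _ _))

Σ<-extend : ∀ {m n} f → m ≤ n → Σ< m f ≤ Σ< n f
Σ<-extend {m} f m≤n with ℕₚ.m≤n⇒∃[o]m+o≡n m≤n
... | o , refl = ℕₚ.≤-trans (ℕₚ.m≤m+n _ _) (ℕₚ.≤-reflexive (sym (Σ<-split m o f)))

Σ<-blocks : ∀ N s f → Σ< (N * s) f ≡ Σ< N (λ i → Σ< s (λ j → f (i * s + j)))
Σ<-blocks zero    s f = refl
Σ<-blocks (suc N) s f = trans (Σ<-split s (N * s) f) (cong (λ z → Σ< s f + z)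
  (trans (Σ<-blocks N s (λ x → f (s + x)))
    (Σ<-cong N λ i _ → Σ<-cong s λ j _ → cong f (sym (ℕₚ.+-assoc s (i * s) j)))))

count-Σ< : ∀ {n} (p : Fin n → Bool) (P : ℕ → Bool) → (∀ i → P (toℕ i) ≡ p i) →
  count p ≡ Σ< n (λ x → ⟦ P x ⟧)
count-Σ< {zero}  p P eq = refl
count-Σ< {suc n} p P eq = cong₂ _+_ (cong ⟦_⟧ (sym (eq zero))) (count-Σ< (p ∘ suc) (P ∘ suc) (eq ∘ suc))

differ-refl : ∀ b → differ b b ≡ false
differ-refl true  = refl
differ-refl false = refl

differ-triangle : ∀ a b c → ⟦ differ a c ⟧ ≤ ⟦ differ a b ⟧ + ⟦ differ b c ⟧
differ-triangle true  true  c     = ℕₚ.≤-refl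
differ-triangle false false c     = ℕₚ.≤-refl
differ-triangle true  false c     = ℕₚ.≤-trans (⟦⟧≤1 (differ true c)) (s≤s z≤n)
differ-triangle false true  c     = ℕₚ.≤-trans (⟦⟧≤1 (differ false c)) (s≤s z≤n)

-- Parity and the number of changes.

odd : ℕ → Bool
odd zero    = false
odd (suc n) = not (odd n)

odd-+⟦⟧ : ∀ a {u} v → odd a ≡ u → odd (a + ⟦ differ u v ⟧) ≡ v
odd-+⟦⟧ a {u} v eq with odd a in odd-a
odd-+⟦⟧ a {true}  true  refl | true  rewrite ℕₚ.+-identityʳ a = odd-a
odd-+⟦⟧ a {true}  false refl | true  rewrite ℕₚ.+-comm a 1 | odd-a = refl
odd-+⟦⟧ a {false} true  refl | false rewrite ℕₚ.+-comm a 1 | odd-a = refl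
odd-+⟦⟧ a {false} false refl | false rewrite ℕₚ.+-identityʳ a = odd-a

odd-double : ∀ r a → odd (r + r + a) ≡ odd a
odd-double zero    a = refl
odd-double (suc r) a rewrite ℕₚ.+-suc r r =
  trans (Boolₚ.not-involutive (odd (r + r + a))) (odd-double r a)

-- Different parities rule out equality, so they force a gap of at least one.
odd-gap : ∀ {a b} → a ≤ b → ⟦ differ (odd b) (odd a) ⟧ + a ≤ b
odd-gap {a} {b} a≤b with ℕₚ.m≤n⇒m<n∨m≡n a≤b
... | inj₁ a<b  = ℕₚ.≤-trans (ℕₚ.+-monoˡ-≤ a (⟦⟧≤1 _)) a<b
... | inj₂ refl rewrite differ-refl (odd a) = ℕₚ.≤-refl

-- The first index counts as a change when the value there is true, as if the
-- sequence were preceded by false.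
changeBit : ℕ → Bool → Bool → Bool
changeBit zero    _    now = now
changeBit (suc _) prev now = differ prev now

change : (ℕ → Bool) → ℕ → Bool
change φ i = changeBit i (φ (pred i)) (φ i)

-- The number of changes up to and including the given index. Counting a leading true makes its
-- parity equal to the value of `φ`, as `odd-rank` shows.
rank : (ℕ → Bool) → ℕ → ℕ
rank φ zero    = ⟦ φ 0 ⟧
rank φ (suc i) = rank φ i + ⟦ change φ (suc i) ⟧

Σ<-change : ∀ φ i → Σ< (suc i) (λ x → ⟦ change φ x ⟧) ≡ rank φ i
Σ<-change φ zero    = ℕₚ.+-identityʳ _
Σ<-change φ (suc i) = trans (Σ<-snoc (suc i) (λ x → ⟦ change φ x ⟧)) (cong (_+ ⟦ change φ (suc i) ⟧) (Σ<-change φ i))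

odd-rank : ∀ φ i → odd (rank φ i) ≡ φ i
odd-rank φ zero with φ 0
... | true  = refl
... | false = refl
odd-rank φ (suc i) = odd-+⟦⟧ (rank φ i) (φ (suc i)) (odd-rank φ i)

rank-mono : ∀ φ {i j} → i ≤ j → rank φ i ≤ rank φ j
rank-mono φ {i} i≤j with ℕₚ.m≤n⇒∃[o]m+o≡n i≤j
... | o , refl = go o
  where
  go : ∀ o → rank φ i ≤ rank φ (i + o)
  go zero rewrite ℕₚ.+-identityʳ i = ℕₚ.≤-refl
  go (suc o) rewrite ℕₚ.+-suc i o = ℕₚ.≤-trans (go o) (ℕₚ.m≤m+n _ _)

-- A discrete intermediate value theorem, since `rank` grows by at most one per step. The value 0 is
-- excluded because a sequence beginning with true has rank 1 from the start.
rank-attains : ∀ φ i {v} → 1 ≤ v → v ≤ rank φ i → ∃ λ p → rank φ p ≡ v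
rank-attains φ zero    1≤v v≤ = 0 , ℕₚ.≤-antisym (ℕₚ.≤-trans (⟦⟧≤1 (φ 0)) 1≤v) v≤
rank-attains φ (suc i) {v} 1≤v v≤ with v ℕₚ.≤? rank φ i
... | yes v≤′ = rank-attains φ i 1≤v v≤′
... | no  v≰  = suc i , ℕₚ.≤-antisym
  (ℕₚ.≤-trans (ℕₚ.+-monoʳ-≤ (rank φ i) (⟦⟧≤1 (change φ (suc i))))
    (ℕₚ.≤-trans (ℕₚ.≤-reflexive (ℕₚ.+-comm _ 1)) (ℕₚ.≰⇒> v≰))) v≤

odd≢odd-suc : ∀ a → odd a ≢ odd (suc a)
odd≢odd-suc a eq = Boolₚ.not-¬ refl eq

-- A rank above `k` supplies positions of ranks 1, ..., k + 1. Their values are the parities of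
-- these ranks, so they start with true and alternate. The map `e` allows both the enumeration of
-- all points and that of the left ends of cells.
kMonotone⇒rank≤ : ∀ {k n f} (e : ℕ → Fin n) → (∀ {i j} → i ≤ j → toℕ (e i) ≤ toℕ (e j)) →
  KMonotone k n f → ∀ i → rank (f ∘ e) i ≤ k
kMonotone⇒rank≤ {k} {n} {f} e e-mono kmon i = ℕₚ.≮⇒≥ λ k<rank → kmon (violation k<rank)
  where
  φ : ℕ → Bool
  φ = f ∘ e
  violation : k < rank φ i → Violation k n f
  violation k<rank = e ∘ pos , ordered , starts , alternates
    where
    attained : ∀ (t : Fin (suc k)) → ∃ λ p → rank φ p ≡ suc (toℕ t)
    attained t = rank-attains φ i (s≤s z≤n) (ℕₚ.≤-trans (Finₚ.toℕ<n t) k<rank)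
    pos : Fin (suc k) → ℕ
    pos t = proj₁ (attained t)
    rank-pos-inject₁ : ∀ t → rank φ (pos (inject₁ t)) ≡ suc (toℕ t)
    rank-pos-inject₁ t = trans (proj₂ (attained (inject₁ t))) (cong suc (Finₚ.toℕ-inject₁ t))
    ordered : ∀ t → toℕ (e (pos (inject₁ t))) ≤ toℕ (e (pos (suc t)))
    ordered t = e-mono (ℕₚ.≮⇒≥ λ p>q → ℕₚ.1+n≰n
      (subst₂ _≤_ (proj₂ (attained (suc t))) (rank-pos-inject₁ t) (rank-mono φ (ℕₚ.<⇒≤ p>q))))
    value : ∀ {v} p → rank φ p ≡ v → φ p ≡ odd v
    value p eq = trans (sym (odd-rank φ p)) (cong odd eq)
    starts : φ (pos zero) ≡ true
    starts = value (pos zero) (proj₂ (attained zero))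
    alternates : ∀ t → φ (pos (inject₁ t)) ≢ φ (pos (suc t))
    alternates t eq = odd≢odd-suc (suc (toℕ t))
      (trans (sym (value _ (rank-pos-inject₁ t))) (trans eq (value _ (proj₂ (attained (suc t))))))

-- Along a violation the height starts at 1 or more, being odd, and each alternation forces a strict
-- increase, so it would reach k + 1.
odd-height-kMonotone : ∀ {k n} (h : Fin n → ℕ) → (∀ {i j} → toℕ i ≤ toℕ j → h i ≤ h j) →
  (∀ i → h i ≤ k) → KMonotone k n (odd ∘ h)
odd-height-kMonotone {k} h h-mono h≤k (x , ordered , starts , alternates) =
  ℕₚ.1+n≰n (ℕₚ.≤-trans (subst (λ v → suc v ≤ h (x (fromℕ k))) (Finₚ.toℕ-fromℕ k) (climbs (fromℕ k)))
                        (h≤k (x (fromℕ k))))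
  where
  positive : ∀ a → odd a ≡ true → 1 ≤ a
  positive (suc a) _ = s≤s z≤n
  climbs : ∀ t → suc (toℕ t) ≤ h (x t)
  climbs = <-weakInduction (λ t → suc (toℕ t) ≤ h (x t)) (positive _ starts) step
    where
    step : ∀ t → suc (toℕ (inject₁ t)) ≤ h (x (inject₁ t)) → suc (suc (toℕ t)) ≤ h (x (suc t))
    step t ih = ℕₚ.≤-<-trans (subst (λ v → suc v ≤ h (x (inject₁ t))) (Finₚ.toℕ-inject₁ t) ih)
      (ℕₚ.≤∧≢⇒< (h-mono (ordered t)) (λ eq → alternates t (cong odd eq)))

-- Heights in the window between j and j + 2r are flattened to j and later ones
-- drop by the even number 2r, so parities change only inside the window.
squeeze : ℕ → ℕ → ℕ → ℕ
squeeze j r t = (t ⊓ j) ⊔ (t ∸ (r + r))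

squeeze-mono : ∀ j r {t u} → t ≤ u → squeeze j r t ≤ squeeze j r u
squeeze-mono j r t≤u = ℕₚ.⊔-mono-≤ (ℕₚ.⊓-monoˡ-≤ j t≤u) (ℕₚ.∸-monoˡ-≤ (r + r) t≤u)

-- A height exceeds `k` by at most `A ∸ k`, and twice that amount is subtracted; the flattened part
-- stays at most `j`.
squeeze≤ : ∀ {j k A t} → j ≤ k → t ≤ A → squeeze j (A ∸ k) t ≤ k
squeeze≤ {j} {k} {A} {t} j≤k t≤A = ℕₚ.⊔-lub (ℕₚ.≤-trans (ℕₚ.m⊓n≤n t j) j≤k)
  (ℕₚ.m≤n+o⇒m∸n≤o _ _ (begin
    t                          ≤⟨ t≤A ⟩
    A                          ≤⟨ ℕₚ.m≤n+m∸n A k ⟩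
    k + (A ∸ k)                ≡⟨ ℕₚ.+-comm k (A ∸ k) ⟩
    A ∸ k + k                  ≤⟨ ℕₚ.+-monoˡ-≤ k (ℕₚ.m≤m+n (A ∸ k) (A ∸ k)) ⟩
    A ∸ k + (A ∸ k) + k        ∎))
  where open ℕₚ.≤-Reasoning

inWindow : ℕ → ℕ → ℕ → Bool
inWindow w t j = (j <ᵇ t) ∧ (t <ᵇ j + w)

T⇒≡true : ∀ {b} → Data.Bool.T b → b ≡ true
T⇒≡true {true} _ = refl

-- Heights up to `j` are unchanged, and heights from j + 2r on drop by exactly 2r. Strictly in
-- between the bound is trivial.
squeeze-parity : ∀ j r t → ⟦ differ (odd t) (odd (squeeze j r t)) ⟧ ≤ ⟦ inWindow (r + r) t j ⟧
squeeze-parity j r t with j ℕₚ.<? t | t ℕₚ.<? j + (r + r)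
... | no j≮t | _ rewrite ℕₚ.m≤n⇒m⊓n≡m (ℕₚ.≮⇒≥ j≮t)
                       | ℕₚ.m≥n⇒m⊔n≡m (ℕₚ.m∸n≤m t (r + r)) | differ-refl (odd t) = z≤n
... | yes j<t | yes t< rewrite T⇒≡true (ℕₚ.<⇒<ᵇ j<t) | T⇒≡true (ℕₚ.<⇒<ᵇ t<) = ⟦⟧≤1 _
... | yes j<t | no t≮ with ℕₚ.m≤n⇒∃[o]m+o≡n (ℕₚ.≮⇒≥ t≮)
...   | o , refl
  rewrite ℕₚ.m≥n⇒m⊓n≡n (ℕₚ.<⇒≤ j<t)
        | trans (cong (_+ o) (ℕₚ.+-comm j (r + r))) (ℕₚ.+-assoc (r + r) j o)
        | ℕₚ.m+n∸m≡n (r + r) (j + o) | ℕₚ.m≤n⇒m⊔n≡n (ℕₚ.m≤m+n j o)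
        | odd-double r (j + o) | differ-refl (odd (j + o)) = z≤n

-- For a height below `w` it suffices that `j` is smaller than the height. Otherwise `j = 0`
-- contributes nothing, and lowering `j` and the height together by one preserves the window.
window-count : ∀ K w t → Σ< K (λ j → ⟦ inWindow w t j ⟧) ≤ w
window-count zero    w t       = z≤n
window-count (suc K) w zero    = subst (_≤ w) (sym (trans (Σ<-const K 0) (ℕₚ.*-zeroʳ K))) z≤n
window-count (suc K) w (suc t) with suc t ℕₚ.<? w
... | yes t<w = ℕₚ.≤-trans (before (suc K) (suc t)) (ℕₚ.<⇒≤ t<w)
  where
  before : ∀ K t → Σ< K (λ j → ⟦ inWindow w t j ⟧) ≤ t
  before K t = ℕₚ.≤-trans (Σ<-mono K λ j _ → drop (j <ᵇ t) (t <ᵇ j + w)) (below-count K t)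
    where
    drop : ∀ p q → ⟦ p ∧ q ⟧ ≤ ⟦ p ⟧
    drop true  q = ⟦⟧≤1 q
    drop false q = z≤n
    below-count : ∀ K t → Σ< K (λ j → ⟦ j <ᵇ t ⟧) ≤ t
    below-count zero    t       = z≤n
    below-count (suc K) zero    = ℕₚ.≤-reflexive (trans (Σ<-const K 0) (ℕₚ.*-zeroʳ K))
    below-count (suc K) (suc t) = s≤s (below-count K t)
... | no t≮w = ℕₚ.≤-trans (ℕₚ.≤-reflexive (cong (λ b → ⟦ b ⟧ + Σ< K (λ j → ⟦ inWindow w t j ⟧)) (not-T t≮w))) (window-count K w t)
  where
  not-T : ∀ {a b} → ¬ a < b → (a <ᵇ b) ≡ false
  not-T {a} {b} a≮b with a <ᵇ b in eq
  ... | false = refl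
  ... | true  = ⊥-elim (a≮b (ℕₚ.<ᵇ⇒< a b (subst Data.Bool.T (sym eq) _)))

-- Sums over blocks of equal length.

block-/ : ∀ i s j .{{_ : NonZero s}} → j < s → (i * s + j) / s ≡ i
block-/ i s j j<s = trans (+-distrib-/-∣ˡ j (divides-refl i))
  (trans (cong₂ _+_ (m*n/n≡m i s) (m<n⇒m/n≡0 j<s)) (ℕₚ.+-identityʳ i))

Σ<-blocks-/ : ∀ N s .{{_ : NonZero s}} (f : ℕ → ℕ → ℕ) →
  Σ< (N * s) (λ x → f (x / s) x) ≡ Σ< N (λ i → Σ< s (λ j → f i (i * s + j)))
Σ<-blocks-/ N s f = trans (Σ<-blocks N s (λ x → f (x / s) x))
  (Σ<-cong N λ i _ → Σ<-cong s λ j j<s → cong (λ q → f q (i * s + j)) (block-/ i s j j<s))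

Σ<-differences : ∀ N (R : ℕ → ℕ) → (∀ i → R i ≤ R (suc i)) → Σ< N (λ i → R (suc i) ∸ R i) + R 0 ≡ R N
Σ<-differences zero    R mono = refl
Σ<-differences (suc N) R mono = begin
  Σ< (suc N) (λ i → R (suc i) ∸ R i) + R 0           ≡⟨ cong (_+ R 0) (Σ<-snoc N (λ i → R (suc i) ∸ R i)) ⟩
  Σ< N (λ i → R (suc i) ∸ R i) + (R (suc N) ∸ R N) + R 0
    ≡⟨ swap (Σ< N (λ i → R (suc i) ∸ R i)) (R (suc N) ∸ R N) (R 0) ⟩
  Σ< N (λ i → R (suc i) ∸ R i) + R 0 + (R (suc N) ∸ R N)
    ≡⟨ cong (_+ (R (suc N) ∸ R N)) (Σ<-differences N R mono) ⟩
  R N + (R (suc N) ∸ R N)                            ≡⟨ ℕₚ.m+[n∸m]≡n (mono N) ⟩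
  R (suc N)                                          ∎
  where
  open ≡-Reasoning
  swap : ∀ a b c → a + b + c ≡ a + c + b
  swap = ℕ-Ring.solve-∀

-- Rounding to cells

-- The cells may run past the end of the domain. Positions beyond it are read at the last point,
-- which keeps the order that `kMonotone⇒rank≤` asks for.
clamp : ∀ {n′} → ℕ → Fin (suc n′)
clamp {n′} x = fromℕ< (s≤s (ℕₚ.m⊓n≤n x n′))

toℕ-clamp : ∀ {n′} x → toℕ (clamp {n′} x) ≡ x ⊓ n′
toℕ-clamp {n′} x = Finₚ.toℕ-fromℕ< (s≤s (ℕₚ.m⊓n≤n x n′))

clamp-mono : ∀ {n′ x y} → x ≤ y → toℕ (clamp {n′} x) ≤ toℕ (clamp {n′} y)
clamp-mono {n′} {x} {y} x≤y =
  subst₂ _≤_ (sym (toℕ-clamp x)) (sym (toℕ-clamp y)) (ℕₚ.⊓-monoˡ-≤ n′ x≤y)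

clamp-toℕ : ∀ {n′} (i : Fin (suc n′)) → clamp (toℕ i) ≡ i
clamp-toℕ i = Finₚ.toℕ-injective (trans (toℕ-clamp (toℕ i)) (ℕₚ.m≤n⇒m⊓n≡m (ℕₚ.≤-pred (Finₚ.toℕ<n i))))

-- As `m` is at least 1 / ε, multiplying the farness inequality by `m` removes the rational
-- parameter.
Far⇒hamming : ∀ {k n f ε m} → 1ℚ ℚ.≤ ε ℚ.* ℕtoℚ m → Far k n ε f → ∀ g → KMonotone k n g →
  n ≤ m * hamming f g
Far⇒hamming {k} {n} {f} {ε} {m} 1≤εm far g kmon = ℕtoℚ-cancel-≤ (begin
  ℕtoℚ n                           ≡⟨ ℚₚ.*-identityˡ (ℕtoℚ n) ⟨
  1ℚ ℚ.* ℕtoℚ n                    ≤⟨ ℚₚ.*-monoʳ-≤-nonNeg (ℕtoℚ n) {{nonNeg n}} 1≤εm ⟩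
  ε ℚ.* ℕtoℚ m ℚ.* ℕtoℚ n          ≡⟨ cong (ℚ._* ℕtoℚ n) (ℚₚ.*-comm ε (ℕtoℚ m)) ⟩
  ℕtoℚ m ℚ.* ε ℚ.* ℕtoℚ n          ≡⟨ ℚₚ.*-assoc (ℕtoℚ m) ε (ℕtoℚ n) ⟩
  ℕtoℚ m ℚ.* (ε ℚ.* ℕtoℚ n)        ≤⟨ ℚₚ.*-monoˡ-≤-nonNeg (ℕtoℚ m) {{nonNeg m}} (far g kmon) ⟩
  ℕtoℚ m ℚ.* ℕtoℚ (hamming f g)    ≡⟨ ℕtoℚ-* m (hamming f g) ⟨
  ℕtoℚ (m * hamming f g)           ∎)
  where
  open ℚₚ.≤-Reasoning
  nonNeg : ∀ a → ℚ.NonNegative (ℕtoℚ a)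
  nonNeg a = ℚₚ.normalize-nonNeg a 1

module _ {n′ : ℕ} (s′ : ℕ) (f : Fin (suc n′) → Bool) where
  private
    n s : ℕ
    n = suc n′
    s = suc s′

  extended cellValue : ℕ → Bool
  extended    = f ∘ clamp
  cellValue i = extended (i * s)

  cellError : ℕ → ℕ
  cellError N = Σ< N (λ i → Σ< s (λ j → ⟦ differ (extended (i * s + j)) (cellValue i) ⟧))

  cellChanges : ℕ → ℕ
  cellChanges N = Σ< N (λ i → ⟦ change cellValue i ⟧)

  cellChanges≤ : ∀ {k} N → KMonotone k n f → cellChanges N ≤ k
  cellChanges≤ zero    kmon = z≤n
  cellChanges≤ (suc N) kmon = ℕₚ.≤-trans (ℕₚ.≤-reflexive (Σ<-change cellValue N))
    (kMonotone⇒rank≤ {f = f} (λ i → clamp (i * s)) (λ i≤j → clamp-mono (ℕₚ.*-monoˡ-≤ s i≤j)) kmon N)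

  -- An error in a cell forces the rank to grow before the next cell begins. The left end is never
  -- an error, hence at most `s′` errors per cell, and the growth telescopes to a total rank of at
  -- most `k`.
  cellError≤ : ∀ {k} N → KMonotone k n f → cellError N ≤ s′ * k
  cellError≤ {k} N kmon = begin
    cellError N
      ≤⟨ Σ<-mono N (λ i _ → error i) ⟩
    Σ< N (λ i → s′ * (R (suc i) ∸ R i))
      ≡⟨ Σ<-* N s′ (λ i → R (suc i) ∸ R i) ⟩
    s′ * Σ< N (λ i → R (suc i) ∸ R i)
      ≤⟨ ℕₚ.*-monoʳ-≤ s′ (ℕₚ.m≤m+n _ (R 0)) ⟩
    s′ * (Σ< N (λ i → R (suc i) ∸ R i) + R 0)
      ≡⟨ cong (s′ *_) (Σ<-differences N R R-mono) ⟩
    s′ * R N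
      ≤⟨ ℕₚ.*-monoʳ-≤ s′ (kMonotone⇒rank≤ {f = f} clamp clamp-mono kmon (N * s)) ⟩
    s′ * k ∎
    where
    open ℕₚ.≤-Reasoning
    R : ℕ → ℕ
    R i = rank extended (i * s)
    R-mono : ∀ i → R i ≤ R (suc i)
    R-mono i = rank-mono extended (ℕₚ.m≤n+m (i * s) s)
    errorAt : ∀ i j → j < s′ → ⟦ differ (extended (i * s + suc j)) (cellValue i) ⟧ ≤ R (suc i) ∸ R i
    errorAt i j j<s′ = ℕₚ.m+n≤o⇒m≤o∸n _ (begin
      ⟦ differ (extended (i * s + suc j)) (cellValue i) ⟧ + R i
        ≡⟨ cong₂ (λ u v → ⟦ differ u v ⟧ + R i) (odd-rank extended (i * s + suc j)) (odd-rank extended (i * s)) ⟨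
      ⟦ differ (odd (rank extended (i * s + suc j))) (odd (R i)) ⟧ + R i
        ≤⟨ odd-gap (rank-mono extended (ℕₚ.m≤m+n (i * s) (suc j))) ⟩
      rank extended (i * s + suc j)
        ≤⟨ rank-mono extended (ℕₚ.≤-trans (ℕₚ.+-monoʳ-≤ (i * s) (s≤s (ℕₚ.<⇒≤ j<s′)))
             (ℕₚ.≤-reflexive (ℕₚ.+-comm (i * s) s))) ⟩
      R (suc i) ∎)
    error : ∀ i → Σ< s (λ j → ⟦ differ (extended (i * s + j)) (cellValue i) ⟧) ≤ s′ * (R (suc i) ∸ R i)
    error i = begin
      ⟦ differ (extended (i * s + 0)) (cellValue i) ⟧ + Σ< s′ rest
        ≡⟨ cong (λ b → ⟦ b ⟧ + Σ< s′ rest) (trans (cong (λ x → differ (extended x) (cellValue i))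
             (ℕₚ.+-identityʳ (i * s))) (differ-refl (cellValue i))) ⟩
      Σ< s′ rest                           ≤⟨ Σ<-mono s′ (errorAt i) ⟩
      Σ< s′ (λ _ → R (suc i) ∸ R i)        ≡⟨ Σ<-const s′ (R (suc i) ∸ R i) ⟩
      s′ * (R (suc i) ∸ R i)               ∎
      where
      rest : ℕ → ℕ
      rest j = ⟦ differ (extended (i * s + suc j)) (cellValue i) ⟧

  module _ {k N′ : ℕ} (n≤M : n ≤ suc N′ * s) where
    private
      N excess : ℕ
      N = suc N′
      excess = cellChanges N ∸ k

    -- The candidates for a nearby k-monotone function, one for each window start `j`, with `excess`
    -- in the role of r.
    flattened : ℕ → ℕ → Bool
    flattened j i = odd (squeeze j excess (rank cellValue i))

    flattenedCost : ℕ → ℕ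
    flattenedCost j = Σ< N (λ i → ⟦ differ (cellValue i) (flattened j i) ⟧)

    flattened-kMonotone : ∀ {j} → j ≤ k → KMonotone k n (λ x → flattened j (toℕ x / s))
    flattened-kMonotone {j} j≤k = odd-height-kMonotone
      (λ x → squeeze j excess (rank cellValue (toℕ x / s)))
      (λ x≤y → squeeze-mono j excess (rank-mono cellValue (/-monoˡ-≤ s x≤y)))
      (λ x → squeeze≤ {A = cellChanges N} j≤k
        (ℕₚ.≤-trans (rank-mono cellValue (ℕₚ.≤-pred (m<n*o⇒m/o<n {n = N} {o = s} (ℕₚ.<-≤-trans (Finₚ.toℕ<n x) n≤M))))
          (ℕₚ.≤-reflexive (sym (Σ<-change cellValue N′)))))

    -- Triangle inequality through the rounding, summed cell by cell.
    hamming-flattened : ∀ j → hamming f (λ x → flattened j (toℕ x / s)) ≤ cellError N + s * flattenedCost j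
    hamming-flattened j = begin
      hamming f (λ x → flattened j (toℕ x / s))
        ≡⟨ count-Σ< _ (λ x → differ (extended x) (flattened j (x / s)))
             (λ x → cong (λ y → differ (f y) (flattened j (toℕ x / s))) (clamp-toℕ x)) ⟩
      Σ< n (λ x → ⟦ differ (extended x) (flattened j (x / s)) ⟧)
        ≤⟨ Σ<-extend (λ x → ⟦ differ (extended x) (flattened j (x / s)) ⟧) n≤M ⟩
      Σ< (N * s) (λ x → ⟦ differ (extended x) (flattened j (x / s)) ⟧)
        ≡⟨ Σ<-blocks-/ N s (λ i x → ⟦ differ (extended x) (flattened j i) ⟧) ⟩
      Σ< N (λ i → Σ< s (λ y → ⟦ differ (extended (i * s + y)) (flattened j i) ⟧))
        ≤⟨ Σ<-mono N (λ i _ → Σ<-mono s (λ y _ → differ-triangle (extended (i * s + y)) (cellValue i) (flattened j i))) ⟩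
      Σ< N (λ i → Σ< s (λ y → err i y + cost i))
        ≡⟨ Σ<-cong N (λ i _ → trans (Σ<-+ s (err i) (λ _ → cost i)) (cong (λ z → Σ< s (err i) + z) (Σ<-const s (cost i)))) ⟩
      Σ< N (λ i → Σ< s (err i) + s * cost i)
        ≡⟨ Σ<-+ N (λ i → Σ< s (err i)) (λ i → s * cost i) ⟩
      cellError N + Σ< N (λ i → s * cost i)
        ≡⟨ cong (λ z → cellError N + z) (Σ<-* N s cost) ⟩
      cellError N + s * flattenedCost j ∎
      where
      open ℕₚ.≤-Reasoning
      err : ℕ → ℕ → ℕ
      err i y = ⟦ differ (extended (i * s + y)) (cellValue i) ⟧
      cost : ℕ → ℕ
      cost i = ⟦ differ (cellValue i) (flattened j i) ⟧

    -- Double counting: a cell costs something only for those `j` whose window contains its rank,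
    -- and there are at most `excess + excess` of them.
    total-flattenedCost : Σ< (suc k) flattenedCost ≤ N * (excess + excess)
    total-flattenedCost = begin
      Σ< (suc k) flattenedCost
        ≤⟨ Σ<-mono (suc k) (λ j _ → Σ<-mono N (λ i _ →
             subst (λ b → ⟦ differ b (flattened j i) ⟧ ≤ ⟦ window i j ⟧) (odd-rank cellValue i)
               (squeeze-parity j excess (rank cellValue i)))) ⟩
      Σ< (suc k) (λ j → Σ< N (λ i → ⟦ window i j ⟧))
        ≡⟨ Σ<-swap (suc k) N (λ j i → ⟦ window i j ⟧) ⟩
      Σ< N (λ i → Σ< (suc k) (λ j → ⟦ window i j ⟧))
        ≤⟨ Σ<-mono N (λ i _ → window-count (suc k) (excess + excess) (rank cellValue i)) ⟩
      Σ< N (λ _ → excess + excess)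
        ≡⟨ Σ<-const N (excess + excess) ⟩
      N * (excess + excess) ∎
      where
      open ℕₚ.≤-Reasoning
      window : ℕ → ℕ → Bool
      window i = inWindow (excess + excess) (rank cellValue i)

    -- Each of the k + 1 candidates is k-monotone and therefore expensive, while
    -- `total-flattenedCost` bounds the sum of their costs in terms of `excess`.
    far⇒excess : ∀ {m} → suc N′ * s ≤ 2 * n →
      (∀ g → KMonotone k n g → n ≤ m * hamming f g) →
      4 * m * cellError N < N * s → suc k ≤ 8 * m * excess
    far⇒excess {m} M≤2n far small = ℕₚ.*-cancelʳ-≤ (suc k) (8 * m * excess) (N * s) (begin
      suc k * (N * s)
        ≡⟨ Σ<-const (suc k) (N * s) ⟨
      Σ< (suc k) (λ _ → N * s)
        ≤⟨ Σ<-mono (suc k) (λ j j≤k → costly j (ℕₚ.≤-pred j≤k)) ⟩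
      Σ< (suc k) (λ j → 4 * m * s * flattenedCost j)
        ≡⟨ Σ<-* (suc k) (4 * m * s) flattenedCost ⟩
      4 * m * s * Σ< (suc k) flattenedCost
        ≤⟨ ℕₚ.*-monoʳ-≤ (4 * m * s) total-flattenedCost ⟩
      4 * m * s * (N * (excess + excess))
        ≡⟨ rearrange m s N excess ⟩
      8 * m * excess * (N * s) ∎)
      where
      open ℕₚ.≤-Reasoning
      rearrange : ∀ m s N e → 4 * m * s * (N * (e + e)) ≡ 8 * m * e * (N * s)
      rearrange = ℕ-Ring.solve-∀
      expand : ∀ m e s c → 2 * (2 * (m * (e + s * c))) ≡ 4 * m * e + 4 * m * s * c
      expand = ℕ-Ring.solve-∀
      costly : ∀ j → j ≤ k → N * s ≤ 4 * m * s * flattenedCost j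
      -- Two copies of `N * s` are at most `4 * n`, hence at most `4 * m` times the distance to the
      -- candidate. The rounding error accounts for less than one copy, so the flattening must pay
      -- for the other.
      costly j j≤k = ℕₚ.+-cancelˡ-≤ (N * s) _ _ (begin
        N * s + N * s                     ≡⟨ cong (λ z → N * s + z) (ℕₚ.+-identityʳ (N * s)) ⟨
        2 * (N * s)                       ≤⟨ ℕₚ.*-monoʳ-≤ 2 M≤2n ⟩
        2 * (2 * n)
          ≤⟨ ℕₚ.*-monoʳ-≤ 2 (ℕₚ.*-monoʳ-≤ 2 (ℕₚ.≤-trans (far (λ x → flattened j (toℕ x / s)) (flattened-kMonotone j≤k))
               (ℕₚ.*-monoʳ-≤ m (hamming-flattened j)))) ⟩
        2 * (2 * (m * (cellError N + s * flattenedCost j)))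
          ≡⟨ expand m (cellError N) s (flattenedCost j) ⟩
        4 * m * cellError N + 4 * m * s * flattenedCost j
          ≤⟨ ℕₚ.+-monoˡ-≤ _ (ℕₚ.<⇒≤ small) ⟩
        N * s + 4 * m * s * flattenedCost j ∎)

-- The gap between the two cases and the choice of cells.

resolution : ℕ → ℕ
resolution m = 64 * (m * m)

-- As fractions of `M`, the threshold is at most 1/(8m) and the error at least 1/(4m). The
-- difference 1/(8m) is at least 1/(64 m²).
error-gap : ∀ m M a e .{{_ : NonZero m}} → 8 * m * a ≤ M → M ≤ 4 * m * e →
  resolution m * a + M ≤ resolution m * e
error-gap m M a e fine large = begin
  64 * (m * m) * a + M                     ≡⟨ cong (_+ M) (split m a) ⟩
  8 * m * (8 * m * a) + M                  ≤⟨ ℕₚ.+-mono-≤ (ℕₚ.*-monoʳ-≤ (8 * m) fine)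
                                                (ℕₚ.m≤n*m M (8 * m) {{ℕₚ.m*n≢0 8 m}}) ⟩
  8 * m * M + 8 * m * M                    ≡⟨ double m M ⟩
  16 * m * M                               ≤⟨ ℕₚ.*-monoʳ-≤ (16 * m) large ⟩
  16 * m * (4 * m * e)                     ≡⟨ join m e ⟩
  64 * (m * m) * e                         ∎
  where
  open ℕₚ.≤-Reasoning
  split : ∀ m x → 64 * (m * m) * x ≡ 8 * m * (8 * m * x)
  split = ℕ-Ring.solve-∀
  double : ∀ m x → 8 * m * x + 8 * m * x ≡ 16 * m * x
  double = ℕ-Ring.solve-∀
  join : ∀ m x → 16 * m * (4 * m * x) ≡ 64 * (m * m) * x
  join = ℕ-Ring.solve-∀

-- An excess of (k + 1)/(8m) changes among at most 8m (k + 1) cells is a fraction of at least 1/(64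
-- m²); this product gives `resolution` its form.
changes-gap : ∀ m N s k A → N ≤ 8 * m * suc k → suc k ≤ 8 * m * (A ∸ k) →
  resolution m * (s * k) + N * s ≤ resolution m * (s * A)
changes-gap m N s k A coarse excess = begin
  W * (s * k) + N * s                      ≤⟨ ℕₚ.+-monoʳ-≤ (W * (s * k)) (ℕₚ.*-monoˡ-≤ s N≤) ⟩
  W * (s * k) + W * (A ∸ k) * s            ≡⟨ collect W s k (A ∸ k) ⟩
  W * (s * (k + (A ∸ k)))                  ≡⟨ cong (λ a → W * (s * a)) (ℕₚ.m+[n∸m]≡n k≤A) ⟩
  W * (s * A)                              ∎
  where
  open ℕₚ.≤-Reasoning
  W : ℕ
  W = resolution m
  join : ∀ m x → 8 * m * (8 * m * x) ≡ 64 * (m * m) * x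
  join = ℕ-Ring.solve-∀
  N≤ : N ≤ W * (A ∸ k)
  N≤ = begin
    N                          ≤⟨ coarse ⟩
    8 * m * suc k              ≤⟨ ℕₚ.*-monoʳ-≤ (8 * m) excess ⟩
    8 * m * (8 * m * (A ∸ k))  ≡⟨ join m (A ∸ k) ⟩
    W * (A ∸ k)                ∎
  -- The excess is positive, so the subtraction `A ∸ k` is not truncated.
  k≤A : k ≤ A
  k≤A = ℕₚ.≮⇒≥ λ A<k → ℕₚ.n≮0 (ℕₚ.≤-trans excess
    (ℕₚ.≤-reflexive (trans (cong (8 * m *_) (ℕₚ.m≤n⇒m∸n≡0 (ℕₚ.<⇒≤ A<k))) (ℕₚ.*-zeroʳ (8 * m)))))
  collect : ∀ W s k r → W * (s * k) + W * r * s ≡ W * (s * (k + r))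
  collect = ℕ-Ring.solve-∀

-- `tight` limits the padding, `coarse` keeps an excess of changes visible among the cells, and
-- `fine` keeps the rounding error of a k-monotone function within 1/(8m) of the points.
record Grid (n k m : ℕ) : Set where
  field
    N′ s′  : ℕ
    covers : n ≤ suc N′ * suc s′
    tight  : suc N′ * suc s′ ≤ 2 * n
    coarse : suc N′ ≤ 8 * m * suc k
    fine   : 8 * m * (s′ * k) ≤ suc N′ * suc s′
  N s : ℕ
  N = suc N′
  s = suc s′

-- A small domain is cut into single points, where rounding is exact. A larger one gets exactly 8m
-- (k + 1) cells, of length one more than the rounded-down quotient so that they cover it; as `n`
-- exceeds the number of cells, the padding at most doubles it.
grid : ∀ n k m .{{_ : NonZero m}} → 1 ≤ n → Grid n k m
grid n@(suc n′) k m@(suc _) 1≤n with n ℕₚ.≤? 8 * m * suc k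
... | yes n≤ = record
  { N′ = n′ ; s′ = 0
  ; covers = ℕₚ.≤-reflexive (sym (ℕₚ.*-identityʳ n))
  ; tight = ℕₚ.≤-trans (ℕₚ.≤-reflexive (ℕₚ.*-identityʳ n)) (ℕₚ.m≤m+n n _)
  ; coarse = n≤
  ; fine = ℕₚ.≤-trans (ℕₚ.≤-reflexive (ℕₚ.*-zeroʳ (8 * m))) z≤n
  }
... | no n≰ = record
  { N′ = pred N₀ ; s′ = n / N₀
  ; covers = subst (λ N → n ≤ N * suc (n / N₀)) (sym N₀≡) (begin
      n                             ≡⟨ m≡m%n+[m/n]*n n N₀ ⟩
      n % N₀ + n / N₀ * N₀          ≤⟨ ℕₚ.+-monoˡ-≤ _ (ℕₚ.<⇒≤ (m%n<n n N₀)) ⟩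
      N₀ + n / N₀ * N₀              ≡⟨ ℕₚ.*-comm (suc (n / N₀)) N₀ ⟩
      N₀ * suc (n / N₀)             ∎)
  ; tight = subst (λ N → N * suc (n / N₀) ≤ 2 * n) (sym N₀≡) (begin
      N₀ * suc (n / N₀)             ≡⟨ ℕₚ.*-comm N₀ (suc (n / N₀)) ⟩
      N₀ + n / N₀ * N₀              ≤⟨ ℕₚ.+-mono-≤ (ℕₚ.<⇒≤ (ℕₚ.≰⇒> n≰)) (m/n*n≤m n N₀) ⟩
      n + n                         ≡⟨ cong (λ z → n + z) (ℕₚ.+-identityʳ n) ⟨
      2 * n                         ∎)
  ; coarse = ℕₚ.≤-reflexive N₀≡
  ; fine = subst (λ N → 8 * m * (n / N₀ * k) ≤ N * suc (n / N₀)) (sym N₀≡) (begin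
      8 * m * (n / N₀ * k)          ≡⟨ swap (8 * m) (n / N₀) k ⟩
      8 * m * k * (n / N₀)          ≤⟨ ℕₚ.*-mono-≤ (ℕₚ.*-monoʳ-≤ (8 * m) (ℕₚ.n≤1+n k)) (ℕₚ.n≤1+n (n / N₀)) ⟩
      N₀ * suc (n / N₀)             ∎)
  }
  where
  open ℕₚ.≤-Reasoning
  N₀ : ℕ
  N₀ = 8 * m * suc k
  N₀≡ : suc (pred N₀) ≡ N₀
  N₀≡ = refl
  swap : ∀ a b c → a * (b * c) ≡ a * c * b
  swap = ℕ-Ring.solve-∀

-- The tester on a grid.

module _ {n′ k m : ℕ} .{{_ : NonZero m}} (G : Grid (suc n′) k m) where
  open Grid G
  private
    n W : ℕ
    n = suc n′
    W = resolution m

    instance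
      W≢0 : NonZero W
      W≢0 = ℕₚ.m*n≢0 64 (m * m) {{_}} {{ℕₚ.m*n≢0 m m}}
      Ω≢0 : NonZero (length (upTo (N * s)))
      Ω≢0 = subst NonZero (sym (length-upTo (N * s))) _

  -- The sampled point, the left end of its cell and that of the preceding cell. For the first cell
  -- `pred` repeats the cell itself, a default that `changeBit` ignores.
  gridPoints : ℕ → Vec (Fin n) 3
  gridPoints x = clamp x ∷ clamp (x / s * s) ∷ clamp (pred (x / s) * s) ∷ []

  errorBit changeBitAt : ℕ × Vec Bool 3 → Bool
  errorBit    (x , here ∷ cell ∷ prev ∷ []) = differ here cell
  changeBitAt (x , here ∷ cell ∷ prev ∷ []) = changeBit (x / s) prev cell

  count-errorBit : ∀ f → countOf (errorBit ∘ read gridPoints f) (upTo (N * s)) ≡ cellError s′ f N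
  count-errorBit f = trans (countOf-upTo (errorBit ∘ read gridPoints f) (N * s))
    (Σ<-blocks-/ N s (λ i x → ⟦ differ (f (clamp x)) (f (clamp (i * s))) ⟧))

  count-changeBit : ∀ f → countOf (changeBitAt ∘ read gridPoints f) (upTo (N * s)) ≡ s * cellChanges s′ f N
  count-changeBit f = begin
    countOf (changeBitAt ∘ read gridPoints f) (upTo (N * s))
      ≡⟨ countOf-upTo (changeBitAt ∘ read gridPoints f) (N * s) ⟩
    Σ< (N * s) (λ x → ⟦ change (cellValue s′ f) (x / s) ⟧)
      ≡⟨ Σ<-blocks-/ N s (λ i _ → ⟦ change (cellValue s′ f) i ⟧) ⟩
    Σ< N (λ i → Σ< s (λ _ → ⟦ change (cellValue s′ f) i ⟧))
      ≡⟨ Σ<-cong N (λ i _ → Σ<-const s ⟦ change (cellValue s′ f) i ⟧) ⟩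
    Σ< N (λ i → s * ⟦ change (cellValue s′ f) i ⟧)
      ≡⟨ Σ<-* N s (λ i → ⟦ change (cellValue s′ f) i ⟧) ⟩
    s * cellChanges s′ f N ∎
    where open ≡-Reasoning

  -- The thresholds are the bounds of `cellError≤` and `cellChanges≤` for k-monotone functions, the
  -- second scaled by `s` because a uniform point meets each cell in `s` ways.
  gridTester : Tester n (sampleSize W * 3)
  gridTester = meanTester gridPoints W (upTo (N * s)) errorBit changeBitAt (s′ * k) (s * k)

  -- The cases are split by whether the rounding error reaches the fraction 1/(4m) of the padded
  -- domain.
  far⇒large : ∀ f → (∀ g → KMonotone k n g → n ≤ m * hamming f g) →
    (W * (s′ * k) + N * s ≤ W * cellError s′ f N) ⊎ (W * (s * k) + N * s ≤ W * (s * cellChanges s′ f N))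
  far⇒large f far = Sum.map
    (error-gap m (N * s) (s′ * k) (cellError s′ f N) fine)
    (λ small → changes-gap m N s k (cellChanges s′ f N) coarse
      (far⇒excess s′ f {k} {N′} covers {m} tight far small))
    (ℕₚ.≤-<-connex (N * s) (4 * m * cellError s′ f N))

  gridTester-isKMonTester : ∀ ε → 1ℚ ℚ.≤ ε ℚ.* ℕtoℚ m → IsKMonTester k n ε gridTester
  gridTester-isKMonTester ε 1≤εm =
    meanTester-isDistribution gridPoints W (upTo (N * s)) errorBit changeBitAt (s′ * k) (s * k) ,
    λ f → accepts f , rejects f
    where
    accepts : ∀ f → KMonotone k n f → + 2 ℚ./ 3 ℚ.≤ accProb gridTester f
    accepts f kmon = meanTester-accepts gridPoints W (upTo (N * s)) errorBit changeBitAt (s′ * k) (s * k) f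
      (ℕₚ.≤-trans (ℕₚ.≤-reflexive (count-errorBit f)) (cellError≤ s′ f N kmon))
      (ℕₚ.≤-trans (ℕₚ.≤-reflexive (count-changeBit f)) (ℕₚ.*-monoʳ-≤ s (cellChanges≤ s′ f N kmon)))
    rejects : ∀ f → Far k n ε f → accProb gridTester f ℚ.≤ + 1 ℚ./ 3
    rejects f far = meanTester-rejects gridPoints W (upTo (N * s)) errorBit changeBitAt (s′ * k) (s * k) f
      (large (far⇒large f (Far⇒hamming {f = f} {ε} {m} 1≤εm far)))
      where
      large : (W * (s′ * k) + N * s ≤ W * cellError s′ f N) ⊎ (W * (s * k) + N * s ≤ W * (s * cellChanges s′ f N)) →
        (W * (s′ * k) + length (upTo (N * s)) ≤ W * countOf (errorBit ∘ read gridPoints f) (upTo (N * s))) ⊎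
        (W * (s * k) + length (upTo (N * s)) ≤ W * countOf (changeBitAt ∘ read gridPoints f) (upTo (N * s)))
      large rewrite length-upTo (N * s) | count-errorBit f | count-changeBit f = λ l → l

-- The query bound and the conclusion.

quartic≤septic : ∀ a b c m .{{_ : NonZero m}} →
  a * (b * (m * m) * (b * (m * m))) * c ≤ a * (b * b) * c * (m ^ 7) * 1
quartic≤septic a b c m = begin
  a * (b * (m * m) * (b * (m * m))) * c                ≡⟨ identity a b c m ⟩
  -- The construction uses order m⁴ queries, which is within m⁷ because `m` is positive.
  a * (b * b) * c * (m * (m * (m * (m * 1))))          ≤⟨ ℕₚ.*-monoʳ-≤ (a * (b * b) * c) (ℕₚ.^-monoʳ-≤ m {4} {7} (ℕₚ.m≤m+n 4 3)) ⟩
  a * (b * b) * c * m ^ 7                              ≡⟨ ℕₚ.*-identityʳ _ ⟨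
  a * (b * b) * c * m ^ 7 * 1                          ∎
  where
  open ℕₚ.≤-Reasoning
  identity : ∀ a b c m →
    a * (b * (m * m) * (b * (m * m))) * c ≡ a * (b * b) * c * (m * (m * (m * (m * 1))))
  identity = ℕ-Ring.solve-∀

theorem1p5 : Σ ℕ λ C → Σ ℕ λ c →
    ∀ (ε : ℚ) → 0ℚ ℚ.< ε →
    ∀ (m : ℕ) → 1ℚ ℚ.≤ ε ℚ.* ℕtoℚ m →
    Σ ℕ λ q → (q ≤ C * (m ^ 7) * (suc ⌊log₂ m ⌋ ^ c)) ×
    (∀ (n : ℕ) → 1 ≤ n → ∀ (k : ℕ) →
    Σ (Tester n q) λ t → IsKMonTester k n ε t)
-- Three queries for each of 24 W² samples with W = 64 m²; the logarithmic factor has exponent zero.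
theorem1p5 = 24 * (64 * 64) * 3 , 0 , solution
  where
  solution : ∀ (ε : ℚ) → 0ℚ ℚ.< ε →
    ∀ (m : ℕ) → 1ℚ ℚ.≤ ε ℚ.* ℕtoℚ m →
    Σ ℕ λ q → (q ≤ 24 * (64 * 64) * 3 * (m ^ 7) * (suc ⌊log₂ m ⌋ ^ 0)) ×
    (∀ (n : ℕ) → 1 ≤ n → ∀ (k : ℕ) →
    Σ (Tester n q) λ t → IsKMonTester k n ε t)
  -- For `m = 0` the assumption on `m` would read 1 ≤ 0.
  solution ε 0<ε zero 1≤ε0 with () ← ℕtoℚ-cancel-≤ {1} {0} (subst (1ℚ ℚ.≤_) (ℚₚ.*-zeroʳ ε) 1≤ε0)
  solution ε 0<ε m@(suc _) 1≤εm = sampleSize (resolution m) * 3 , small , testers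
    where
    small : sampleSize (resolution m) * 3 ≤ 24 * (64 * 64) * 3 * (m ^ 7) * 1
    small = quartic≤septic 24 64 3 m
    testers : ∀ (n : ℕ) → 1 ≤ n → ∀ (k : ℕ) → Σ (Tester n (sampleSize (resolution m) * 3)) λ t → IsKMonTester k n ε t
    testers (suc n′) 1≤n k = gridTester G , gridTester-isKMonTester G ε 1≤εm
      where
      G : Grid (suc n′) k m
      G = grid (suc n′) k m 1≤n
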